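{- Let $\mathcal{L}$ denote either the $\mathbf{Q}$-vector space $\mathscr{L} \subset \mathbf{C}$ of complex logarithms of algebraic numbers, or, for a prime $p$, the $\mathbf{Q}$-vector space $\mathscr{L}_p \subset \mathbf{C}_p$ of $p$-adic logarithms of algebraic numbers. Suppose that the Structural Rank Conjecture holds for $\mathcal{L}$, that is: for all $m,n \ge 1$ and every $m \times n$ matrix $M$ with entries in $\mathcal{L}$, written as $M = \sum_{i=1}^k M_i \lambda_i$ with $M_i \in M_{m\times n}(\mathbf{Q})$ and $\lambda_1,\dots,\lambda_k \in \mathcal{L}$ linearly independent over $\mathbf{Q}$, the rank of $M$ equals the rank of $\sum_{i=1}^k M_i x_i$ viewed as a matrix over the rational function field $\mathbf{Q}(x_1,\dots,x_k)$. Then the Matrix Coefficient Conjecture holds for $\mathcal{L}$, that is: for every $n \ge 1$ and every $M \in M_{n\times n}(\mathcal{L})$ with $\det(M)=0$, there exist nonzero vectors $w, v \in \mathbf{Q}^n$ such that $\langle w, Mv\rangle = 0$.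
   Context: $\mathscr{L} = \{x \in \mathbf{C} : e^x \in \overline{\mathbf{Q}}\}$. For a prime $p$, fix an embedding $\overline{\mathbf{Q}} \subset \mathbf{C}_p$ and let $\mathscr{L}_p = \{\log_p(x) : x \in \overline{\mathbf{Q}}^*\} \subset \mathbf{C}_p$, where $\log_p$ is Iwasawa's $p$-adic logarithm on $\mathbf{C}_p^*$ (normalized by $\log_p(p)=0$). $\langle\ ,\ \rangle$ denotes the usual dot product. The rank of $M$ is its rank over $\mathbf{C}$ (respectively $\mathbf{C}_p$). -}

module Defs where

open import Level using (0ℓ)
open import Algebra.Bundles using (RawRing; CommutativeRing; AbelianGroup; CommutativeMonoid)
open import Algebra.Morphism.Structures using (module RingMorphisms)
import Algebra.Definitions.RawSemiring as RawSemiringDefs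
import Algebra.Properties.CommutativeSemigroup as CommutativeSemigroupProperties
open import Data.Fin.Base using (Fin; zero; suc; toℕ; punchIn)
open import Data.Integer.Base using (+_; -1ℤ)
import Data.Integer.Base as ℤ
open import Data.List.Base using (List; []; _∷_; _++_; map)
open import Data.List.Relation.Unary.All using (All)
open import Data.List.Relation.Unary.Any using (Any)
open import Data.Nat.Base using (ℕ; zero; suc; _!)
import Data.Nat.Base as ℕ
import Data.Nat.Properties as ℕ
open import Data.Product.Base using (_×_; _,_; ∃-syntax; ∃₂)
open import Data.Rational.Base using (ℚ; 0ℚ; 1ℚ; ½; ∣_∣; _/_; Positive)
import Data.Rational.Base as ℚ
import Data.Rational.Properties as ℚ
open import Data.Rational.Solver using (module +-*-Solver)
open import Data.Sum.Base using (_⊎_; inj₁; inj₂)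
import Data.Sum.Base as Sum
open import Data.Vec.Functional using (Vector)
open import Function.Base using (_∘_)
open import Function.Bundles using (_⇔_)
open import Relation.Binary.PropositionalEquality
  using (_≡_; _≢_; refl; sym; trans; cong; cong₂; subst)
import Relation.Binary.Reasoning.Setoid as SetoidReasoning
open import Relation.Nullary.Decidable.Core using (yes; no)
open import Relation.Nullary.Negation using (¬_)
open import Relation.Unary using (Pred)

Matrix : Set → ℕ → ℕ → Set
Matrix A m n = Fin m → Fin n → A

-- Only the operations of K are used; HasRank is meant for K a field.
module Linear (K : RawRing 0ℓ 0ℓ) where
  open RawRing K
  open RawSemiringDefs rawSemiring using (sum; _^_)

  infixl 7 _·_

  ⟨_,_⟩ : ∀ {n} → Vector Carrier n → Vector Carrier n → Carrier
  ⟨ u , v ⟩ = sum λ i → u i * v i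

  _·_ : ∀ {m n} → Matrix Carrier m n → Vector Carrier n → Vector Carrier m
  (M · v) i = ⟨ M i , v ⟩

  combination : ∀ {m r} → Vector Carrier r → (Fin r → Vector Carrier m) →
                Vector Carrier m
  combination c b i = sum λ l → c l * b l i

  LinearlyIndependent : ∀ {m r} → (Fin r → Vector Carrier m) → Set
  LinearlyIndependent b =
    ∀ c → (∀ i → combination c b i ≈ 0#) → ∀ l → c l ≈ 0#

  InSpan : ∀ {m r} → (Fin r → Vector Carrier m) → Pred (Vector Carrier m) 0ℓ
  InSpan b y = ∃[ c ] ∀ i → y i ≈ combination c b i

  columns : ∀ {m n} → Matrix Carrier m n → Fin n → Vector Carrier m
  columns M j i = M i j

  -- The column space of M has a basis of r vectors.
  HasRank : ∀ {m n} → Matrix Carrier m n → ℕ → Set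
  HasRank {m} M r = ∃[ b ] LinearlyIndependent {m} {r} b ×
                           (∀ y → InSpan b y ⇔ InSpan (columns M) y)

  -- Laplace expansion along the first row.
  det : ∀ {n} → Matrix Carrier n n → Carrier
  det {zero}  M = 1#
  det {suc n} M = sum λ j →
    (- 1#) ^ toℕ j * (M zero j * det λ i l → M (suc i) (punchIn j l))

-- A polynomial is the list of its coefficients, constant term first.
module Algebraicity (K : RawRing 0ℓ 0ℓ) where
  open RawRing K

  eval : List Carrier → Carrier → Carrier
  eval []      z = 0#
  eval (a ∷ p) z = a + z * eval p z

  AlgebraicOver : Pred Carrier 0ℓ → Pred Carrier 0ℓ
  AlgebraicOver F z =
    ∃[ p ] All F p × Any (λ a → ¬ a ≈ 0#) p × eval p z ≈ 0#

  -- Monic polynomials of positive degree suffice.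
  AlgebraicallyClosed : Set
  AlgebraicallyClosed = ∀ a p → ∃[ z ] eval (a ∷ p ++ 1# ∷ []) z ≈ 0#

Cauchy : (ℕ → ℚ) → Set
Cauchy s = ∀ ε → 0ℚ ℚ.< ε → ∃[ N ] ∀ m n → N ℕ.≤ m → N ℕ.≤ n →
           ∣ s m ℚ.- s n ∣ ℚ.< ε

record ℝ : Set where
  constructor mkℝ
  field
    seq    : ℕ → ℚ
    cauchy : Cauchy seq

open ℝ

module RealArithmetic where

  ∣a-a∣<ε : ∀ a ε → 0ℚ ℚ.< ε → ∣ a ℚ.- a ∣ ℚ.< ε
  ∣a-a∣<ε a ε 0<ε = subst (λ d → ∣ d ∣ ℚ.< ε) (sym (ℚ.+-inverseʳ a)) 0<ε

  half-pos : ∀ {ε} → 0ℚ ℚ.< ε → 0ℚ ℚ.< ½ ℚ.* ε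
  half-pos {ε} 0<ε =
    subst (ℚ._< ½ ℚ.* ε) (ℚ.*-zeroʳ ½) (ℚ.*-monoʳ-<-pos ½ 0<ε)

  halves : ∀ ε → ½ ℚ.* ε ℚ.+ ½ ℚ.* ε ≡ ε
  halves ε = trans (sym (ℚ.*-distribʳ-+ ε ½ ½)) (ℚ.*-identityˡ ε)

  +-cauchy : ∀ s t → Cauchy s → Cauchy t → Cauchy (λ n → s n ℚ.+ t n)
  +-cauchy s t cs ct ε 0<ε
    with cs (½ ℚ.* ε) (half-pos 0<ε) | ct (½ ℚ.* ε) (half-pos 0<ε)
  ... | N₁ , h₁ | N₂ , h₂ = N₁ ℕ.+ N₂ , close
    where
    open ℚ.≤-Reasoning
    regroup : ∀ a b c d →
              (a ℚ.+ b) ℚ.- (c ℚ.+ d) ≡ (a ℚ.- c) ℚ.+ (b ℚ.- d)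
    regroup = solve 4 (λ a b c d →
      (a :+ b) :- (c :+ d) := (a :- c) :+ (b :- d)) refl
      where open +-*-Solver
    close : ∀ m n → N₁ ℕ.+ N₂ ℕ.≤ m → N₁ ℕ.+ N₂ ℕ.≤ n →
            ∣ (s m ℚ.+ t m) ℚ.- (s n ℚ.+ t n) ∣ ℚ.< ε
    close m n N≤m N≤n = begin-strict
      ∣ (s m ℚ.+ t m) ℚ.- (s n ℚ.+ t n) ∣
        ≡⟨ cong ∣_∣ (regroup (s m) (t m) (s n) (t n)) ⟩
      ∣ (s m ℚ.- s n) ℚ.+ (t m ℚ.- t n) ∣
        ≤⟨ ℚ.∣p+q∣≤∣p∣+∣q∣ (s m ℚ.- s n) (t m ℚ.- t n) ⟩
      ∣ s m ℚ.- s n ∣ ℚ.+ ∣ t m ℚ.- t n ∣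
        <⟨ ℚ.+-mono-< (h₁ m n (ℕ.m+n≤o⇒m≤o N₁ N≤m) (ℕ.m+n≤o⇒m≤o N₁ N≤n))
                      (h₂ m n (ℕ.m+n≤o⇒n≤o N₁ N≤m) (ℕ.m+n≤o⇒n≤o N₁ N≤n)) ⟩
      ½ ℚ.* ε ℚ.+ ½ ℚ.* ε
        ≡⟨ halves ε ⟩
      ε ∎

  neg-cauchy : ∀ s → Cauchy s → Cauchy (λ n → ℚ.- s n)
  neg-cauchy s cs ε 0<ε with cs ε 0<ε
  ... | N , h = N , λ m n N≤m N≤n →
    subst (ℚ._< ε) (same (s m) (s n)) (h m n N≤m N≤n)
    where
    regroup : ∀ a b → ℚ.- a ℚ.- (ℚ.- b) ≡ ℚ.- (a ℚ.- b)
    regroup = solve 2 (λ a b → :- a :- (:- b) := :- (a :- b)) refl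
      where open +-*-Solver
    same : ∀ a b → ∣ a ℚ.- b ∣ ≡ ∣ ℚ.- a ℚ.- (ℚ.- b) ∣
    same a b = sym (trans (cong ∣_∣ (regroup a b)) (ℚ.∣-p∣≡∣p∣ (a ℚ.- b)))

  prefixBound : (ℕ → ℚ) → ℕ → ℚ
  prefixBound s zero    = ∣ s 0 ∣
  prefixBound s (suc n) = ∣ s (suc n) ∣ ℚ.+ prefixBound s n

  0≤prefixBound : ∀ s n → 0ℚ ℚ.≤ prefixBound s n
  0≤prefixBound s zero    = ℚ.0≤∣p∣ (s 0)
  0≤prefixBound s (suc n) =
    ℚ.+-mono-≤ (ℚ.0≤∣p∣ (s (suc n))) (0≤prefixBound s n)

  a≤a+b : ∀ a b → 0ℚ ℚ.≤ b → a ℚ.≤ a ℚ.+ b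
  a≤a+b a b 0≤b = subst (ℚ._≤ a ℚ.+ b) (ℚ.+-identityʳ a) (ℚ.+-monoʳ-≤ a 0≤b)

  b≤a+b : ∀ a b → 0ℚ ℚ.≤ a → b ℚ.≤ a ℚ.+ b
  b≤a+b a b 0≤a = subst (ℚ._≤ a ℚ.+ b) (ℚ.+-identityˡ b) (ℚ.+-monoˡ-≤ b 0≤a)

  last≤prefixBound : ∀ s n → ∣ s n ∣ ℚ.≤ prefixBound s n
  last≤prefixBound s zero    = ℚ.≤-refl
  last≤prefixBound s (suc n) = a≤a+b ∣ s (suc n) ∣ _ (0≤prefixBound s n)

  ≤prefixBound : ∀ s {m n} → m ℕ.≤′ n → ∣ s m ∣ ℚ.≤ prefixBound s n
  ≤prefixBound s {m} {.m} (ℕ.≤′-reflexive refl) = last≤prefixBound s m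
  ≤prefixBound s {m} {suc n} (ℕ.≤′-step m≤n) =
    ℚ.≤-trans (≤prefixBound s m≤n)
              (b≤a+b ∣ s (suc n) ∣ (prefixBound s n) (ℚ.0≤∣p∣ (s (suc n))))

  0<1 : 0ℚ ℚ.< 1ℚ
  0<1 = ℚ.positive⁻¹ 1ℚ

  bounded : ∀ s → Cauchy s → ∃[ B ] 0ℚ ℚ.< B × ∀ n → ∣ s n ∣ ℚ.≤ B
  bounded s cs with cs 1ℚ 0<1
  ... | N , h = 1ℚ ℚ.+ P , ℚ.<-≤-trans 0<1 (a≤a+b 1ℚ P 0≤P) , bound
    where
    open ℚ.≤-Reasoning
    P = prefixBound s N
    0≤P = 0≤prefixBound s N
    regroup : ∀ a b → a ≡ (a ℚ.- b) ℚ.+ b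
    regroup = solve 2 (λ a b → a := (a :- b) :+ b) refl
      where open +-*-Solver
    bound : ∀ n → ∣ s n ∣ ℚ.≤ 1ℚ ℚ.+ P
    bound n with n ℕ.≤? N
    ... | yes n≤N = ℚ.≤-trans (≤prefixBound s (ℕ.≤⇒≤′ n≤N))
                              (b≤a+b 1ℚ P (ℚ.<⇒≤ 0<1))
    ... | no  n≰N = begin
      ∣ s n ∣                          ≡⟨ cong ∣_∣ (regroup (s n) (s N)) ⟩
      ∣ (s n ℚ.- s N) ℚ.+ s N ∣        ≤⟨ ℚ.∣p+q∣≤∣p∣+∣q∣ (s n ℚ.- s N) (s N) ⟩
      ∣ s n ℚ.- s N ∣ ℚ.+ ∣ s N ∣
        ≤⟨ ℚ.+-mono-≤ (ℚ.<⇒≤ (h n N (ℕ.<⇒≤ (ℕ.≰⇒> n≰N)) ℕ.≤-refl))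
                      (last≤prefixBound s N) ⟩
      1ℚ ℚ.+ P                         ∎

  shrink : ∀ B → 0ℚ ℚ.< B → ∀ ε → 0ℚ ℚ.< ε →
           ∃[ δ ] 0ℚ ℚ.< δ × B ℚ.* δ ≡ ½ ℚ.* ε
  shrink B 0<B ε 0<ε = B⁻¹ ℚ.* (½ ℚ.* ε) , 0<δ , Bδ
    where
    instance
      B-pos : Positive B
      B-pos = ℚ.positive 0<B
      B-nonZero : ℚ.NonZero B
      B-nonZero = ℚ.pos⇒nonZero B
    B⁻¹ = ℚ.1/ B
    instance
      B⁻¹-pos : Positive B⁻¹
      B⁻¹-pos = ℚ.1/pos⇒pos B
    0<δ : 0ℚ ℚ.< B⁻¹ ℚ.* (½ ℚ.* ε)
    0<δ = subst (ℚ._< B⁻¹ ℚ.* (½ ℚ.* ε)) (ℚ.*-zeroʳ B⁻¹)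
                (ℚ.*-monoʳ-<-pos B⁻¹ (half-pos 0<ε))
    Bδ : B ℚ.* (B⁻¹ ℚ.* (½ ℚ.* ε)) ≡ ½ ℚ.* ε
    Bδ = trans (sym (ℚ.*-assoc B B⁻¹ (½ ℚ.* ε)))
         (trans (cong (ℚ._* (½ ℚ.* ε)) (ℚ.*-inverseʳ B))
                (ℚ.*-identityˡ (½ ℚ.* ε)))

  *-bound : ∀ {B δ} a b → 0ℚ ℚ.< B → ∣ a ∣ ℚ.≤ B → ∣ b ∣ ℚ.< δ →
            ∣ a ℚ.* b ∣ ℚ.< B ℚ.* δ
  *-bound {B} {δ} a b 0<B a≤B b<δ = begin-strict
    ∣ a ℚ.* b ∣        ≡⟨ ℚ.∣p*q∣≡∣p∣*∣q∣ a b ⟩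
    ∣ a ∣ ℚ.* ∣ b ∣    ≤⟨ ℚ.*-monoʳ-≤-nonNeg ∣ b ∣ a≤B ⟩
    B ℚ.* ∣ b ∣        <⟨ ℚ.*-monoʳ-<-pos B b<δ ⟩
    B ℚ.* δ            ∎
    where
    open ℚ.≤-Reasoning
    instance
      B-pos : Positive B
      B-pos = ℚ.positive 0<B
      ∣b∣-nonNeg : ℚ.NonNegative ∣ b ∣
      ∣b∣-nonNeg = ℚ.∣-∣-nonNeg b

  *-cauchy : ∀ s t → Cauchy s → Cauchy t → Cauchy (λ n → s n ℚ.* t n)
  *-cauchy s t cs ct ε 0<ε with bounded s cs | bounded t ct
  ... | B , 0<B , s≤B | C , 0<C , t≤C
    with shrink B 0<B ε 0<ε | shrink C 0<C ε 0<ε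
  ... | δ , 0<δ , Bδ | η , 0<η , Cη with ct δ 0<δ | cs η 0<η
  ... | N₁ , h₁ | N₂ , h₂ = N₁ ℕ.+ N₂ , close
    where
    open ℚ.≤-Reasoning
    regroup : ∀ a b c d →
              a ℚ.* b ℚ.- c ℚ.* d ≡ a ℚ.* (b ℚ.- d) ℚ.+ d ℚ.* (a ℚ.- c)
    regroup = solve 4 (λ a b c d →
      a :* b :- c :* d := a :* (b :- d) :+ d :* (a :- c)) refl
      where open +-*-Solver
    close : ∀ m n → N₁ ℕ.+ N₂ ℕ.≤ m → N₁ ℕ.+ N₂ ℕ.≤ n →
            ∣ s m ℚ.* t m ℚ.- s n ℚ.* t n ∣ ℚ.< ε
    close m n N≤m N≤n = begin-strict
      ∣ s m ℚ.* t m ℚ.- s n ℚ.* t n ∣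
        ≡⟨ cong ∣_∣ (regroup (s m) (t m) (s n) (t n)) ⟩
      ∣ s m ℚ.* (t m ℚ.- t n) ℚ.+ t n ℚ.* (s m ℚ.- s n) ∣
        ≤⟨ ℚ.∣p+q∣≤∣p∣+∣q∣ (s m ℚ.* (t m ℚ.- t n)) (t n ℚ.* (s m ℚ.- s n)) ⟩
      ∣ s m ℚ.* (t m ℚ.- t n) ∣ ℚ.+ ∣ t n ℚ.* (s m ℚ.- s n) ∣
        <⟨ ℚ.+-mono-<
             (*-bound (s m) (t m ℚ.- t n) 0<B (s≤B m)
               (h₁ m n (ℕ.m+n≤o⇒m≤o N₁ N≤m) (ℕ.m+n≤o⇒m≤o N₁ N≤n)))
             (*-bound (t n) (s m ℚ.- s n) 0<C (t≤C n)
               (h₂ m n (ℕ.m+n≤o⇒n≤o N₁ N≤m) (ℕ.m+n≤o⇒n≤o N₁ N≤n))) ⟩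
      B ℚ.* δ ℚ.+ C ℚ.* η
        ≡⟨ cong₂ ℚ._+_ Bδ Cη ⟩
      ½ ℚ.* ε ℚ.+ ½ ℚ.* ε
        ≡⟨ halves ε ⟩
      ε ∎

open RealArithmetic

infixl 6 _+ᴿ_ _-ᴿ_
infixl 7 _*ᴿ_
infix  8 -ᴿ_
infix  4 _≈ᴿ_ ∣_-_∣<_

fromℚ : ℚ → ℝ
fromℚ q = mkℝ (λ _ → q) λ ε 0<ε → 0 , λ _ _ _ _ → ∣a-a∣<ε q ε 0<ε

_+ᴿ_ : ℝ → ℝ → ℝ
x +ᴿ y = mkℝ (λ n → seq x n ℚ.+ seq y n)
               (+-cauchy (seq x) (seq y) (cauchy x) (cauchy y))

_*ᴿ_ : ℝ → ℝ → ℝ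
x *ᴿ y = mkℝ (λ n → seq x n ℚ.* seq y n)
               (*-cauchy (seq x) (seq y) (cauchy x) (cauchy y))

-ᴿ_ : ℝ → ℝ
-ᴿ x = mkℝ (λ n → ℚ.- seq x n) (neg-cauchy (seq x) (cauchy x))

_-ᴿ_ : ℝ → ℝ → ℝ
x -ᴿ y = x +ᴿ (-ᴿ y)

_≈ᴿ_ : ℝ → ℝ → Set
x ≈ᴿ y = ∀ ε → 0ℚ ℚ.< ε → ∃[ N ] ∀ n → N ℕ.≤ n → ∣ seq x n ℚ.- seq y n ∣ ℚ.< ε

-- The extra margin δ < ε makes this the strict inequality of reals.
∣_-_∣<_ : ℝ → ℝ → ℚ → Set
∣ x - y ∣< ε = ∃[ δ ] δ ℚ.< ε ×
               ∃[ N ] ∀ n → N ℕ.≤ n → ∣ seq x n ℚ.- seq y n ∣ ℚ.≤ δ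

record ℂ : Set where
  constructor _+i_
  field
    re im : ℝ

open ℂ

ℂ-rawRing : RawRing 0ℓ 0ℓ
ℂ-rawRing = record
  { Carrier = ℂ
  ; _≈_     = λ z w → (re z ≈ᴿ re w) × (im z ≈ᴿ im w)
  ; _+_     = λ z w → (re z +ᴿ re w) +i (im z +ᴿ im w)
  ; _*_     = λ z w → (re z *ᴿ re w -ᴿ im z *ᴿ im w) +i
                      (re z *ᴿ im w +ᴿ im z *ᴿ re w)
  ; -_      = λ z → (-ᴿ re z) +i (-ᴿ im z)
  ; 0#      = fromℚ 0ℚ +i fromℚ 0ℚ
  ; 1#      = fromℚ 1ℚ +i fromℚ 0ℚ
  }

ℚ→ℂ : ℚ → ℂ
ℚ→ℂ q = fromℚ q +i fromℚ 0ℚ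

_⟶ᶜ_ : (ℕ → ℂ) → ℂ → Set
s ⟶ᶜ w = ∀ ε → 0ℚ ℚ.< ε → ∃[ N ] ∀ n → N ℕ.≤ n →
         ∣ re (s n) - re w ∣< ε × ∣ im (s n) - im w ∣< ε

1/_! : ℕ → ℚ
1/ n ! = (+ 1 / n !) where instance n!≢0 = n ℕ.!≢0

expPartialSum : ℂ → ℕ → ℂ
expPartialSum z n = sum {n} λ j → ℚ→ℂ (1/ toℕ j !) * z ^ toℕ j
  where
  open RawRing ℂ-rawRing
  open RawSemiringDefs rawSemiring using (sum; _^_)

-- The relation e^z = w.
IsExp : ℂ → ℂ → Set
IsExp z w = expPartialSum z ⟶ᶜ w

Rational : (K : RawRing 0ℓ 0ℓ) → (ℚ → RawRing.Carrier K) →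
           Pred (RawRing.Carrier K) 0ℓ
Rational K ι z = ∃[ q ] z ≈ ι q
  where open RawRing K

Q̄ : (K : RawRing 0ℓ 0ℓ) → (ℚ → RawRing.Carrier K) →
    Pred (RawRing.Carrier K) 0ℓ
Q̄ K ι = Algebraicity.AlgebraicOver K (Rational K ι)

ℒ : Pred ℂ 0ℓ
ℒ z = ∃[ w ] IsExp z w × Q̄ ℂ-rawRing ℚ→ℂ w

-- The field of p-adic complex numbers, characterised up to isometric
-- isomorphism as the completion of an algebraic closure of ℚₚ: a complete
-- algebraically closed valued field whose valuation extends the p-adic
-- valuation of ℚ, and in which the elements algebraic over ℚₚ (the closure
-- of ℚ) are dense.  The value group is ℚ, so no reals are involved.

record ℂₚ-Field (p : ℕ) : Set₁ where
  field
    commutativeRing : CommutativeRing 0ℓ 0ℓ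

  open CommutativeRing commutativeRing public hiding (refl; sym; trans)

  field
    1≉0     : ¬ 1# ≈ 0#
    inverse : ∀ x → ¬ x ≈ 0# → ∃[ y ] x * y ≈ 1#

    ι       : ℚ → Carrier
    ι-homo  : RingMorphisms.IsRingHomomorphism ℚ.+-*-rawRing rawRing ι

    ord      : ∀ x → ¬ x ≈ 0# → ℚ
    ord-cong : ∀ {x y} x≉0 y≉0 → x ≈ y → ord x x≉0 ≡ ord y y≉0
    ord-*    : ∀ {x y} x≉0 y≉0 xy≉0 →
               ord (x * y) xy≉0 ≡ ord x x≉0 ℚ.+ ord y y≉0
    ord-+    : ∀ {x y} x≉0 y≉0 x+y≉0 →
               ord x x≉0 ℚ.⊓ ord y y≉0 ℚ.≤ ord (x + y) x+y≉0
    ord-p    : ∀ p≉0 → ord (ι (+ p / 1)) p≉0 ≡ 1ℚ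

  -- By vacuity, ord 0 is +∞ in the following two comparisons.
  _≤ord_ : ℚ → Carrier → Set
  c ≤ord x = ∀ x≉0 → c ℚ.≤ ord x x≉0

  _<ord_ : ℚ → Carrier → Set
  c <ord x = ∀ x≉0 → c ℚ.< ord x x≉0

  IsCauchy : (ℕ → Carrier) → Set
  IsCauchy s = ∀ c → ∃[ N ] ∀ m n → N ℕ.≤ m → N ℕ.≤ n → c ≤ord (s m - s n)

  _⟶_ : (ℕ → Carrier) → Carrier → Set
  s ⟶ x = ∀ c → ∃[ N ] ∀ n → N ℕ.≤ n → c ≤ord (s n - x)

  ℚₚ : Pred Carrier 0ℓ
  ℚₚ x = ∀ c → ∃[ q ] c ≤ord (x - ι q)

  open Algebraicity rawRing

  field
    complete            : ∀ s → IsCauchy s → ∃[ x ] s ⟶ x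
    algebraicallyClosed : AlgebraicallyClosed
    ℚ̄ₚ-dense            : ∀ x c → ∃[ y ] AlgebraicOver ℚₚ y × c ≤ord (x - y)

  open RawSemiringDefs (RawRing.rawSemiring rawRing) using (sum; _^_)

  -- log (1 + x) = x - x²/2 + x³/3 - …
  logPartialSum : Carrier → ℕ → Carrier
  logPartialSum x n =
    sum {n} λ j → ι ((-1ℤ ℤ.^ toℕ j) / suc (toℕ j)) * x ^ suc (toℕ j)

  -- These conditions determine Iwasawa's logarithm uniquely.
  record IwasawaLog : Set where
    field
      log        : ∀ x → ¬ x ≈ 0# → Carrier
      log-cong   : ∀ {x y} x≉0 y≉0 → x ≈ y → log x x≉0 ≈ log y y≉0
      log-*      : ∀ {x y} x≉0 y≉0 xy≉0 →
                   log (x * y) xy≉0 ≈ log x x≉0 + log y y≉0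
      log-series : ∀ {x} → 0ℚ <ord x → ∀ 1+x≉0 →
                   logPartialSum x ⟶ log (1# + x) 1+x≉0
      log-p      : ∀ p≉0 → log (ι (+ p / 1)) p≉0 ≈ 0#

  -- An embedding of Q̄ in ℂₚ has image the set of elements algebraic over ℚ,
  -- whichever embedding is chosen.
  ℒₚ : IwasawaLog → Pred Carrier 0ℓ
  ℒₚ logₚ y = ∃[ x ] Q̄ rawRing ι x × ∃[ x≉0 ] y ≈ IwasawaLog.log logₚ x x≉0

record IntegralDomain : Set₁ where
  field
    commutativeRing : CommutativeRing 0ℓ 0ℓ

  open CommutativeRing commutativeRing public

  field
    1≉0             : ¬ 1# ≈ 0#
    noZeroDivisors  : ∀ x y → x * y ≈ 0# → x ≈ 0# ⊎ y ≈ 0#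

ℚ-domain : IntegralDomain
ℚ-domain = record
  { commutativeRing = ℚ.+-*-commutativeRing
  ; 1≉0             = λ ()
  ; noZeroDivisors  = noZeroDivisors
  }
  where
  noZeroDivisors : ∀ x y → x ℚ.* y ≡ 0ℚ → x ≡ 0ℚ ⊎ y ≡ 0ℚ
  noZeroDivisors x y xy≡0 with x ℚ.≟ 0ℚ
  ... | yes x≡0 = inj₁ x≡0
  ... | no  x≢0 = inj₂ (trans (sym (ℚ.*-identityˡ y))
    (trans (cong (ℚ._* y) (sym (ℚ.*-inverseˡ x)))
    (trans (ℚ.*-assoc (ℚ.1/ x) x y)
    (trans (cong (ℚ.1/ x ℚ.*_) xy≡0) (ℚ.*-zeroʳ (ℚ.1/ x))))))
    where instance x-nonZero = ℚ.≢-nonZero x≢0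

-- R[x], with coefficient lists compared up to trailing zeros.
module Univariate (R : CommutativeRing 0ℓ 0ℓ) where
  open CommutativeRing R
    renaming (refl to ≈-refl; sym to ≈-sym; trans to ≈-trans)
  private module ≈-Reasoning = SetoidReasoning setoid

  infixl 6 _⊕_
  infixl 7 _⊛_ _⊙_
  infix  8 ⊖_
  infix  4 _≋_

  coeff : List Carrier → ℕ → Carrier
  coeff []      i       = 0#
  coeff (a ∷ p) zero    = a
  coeff (a ∷ p) (suc i) = coeff p i

  record _≋_ (p q : List Carrier) : Set where
    constructor mk≋
    field at : ∀ i → coeff p i ≈ coeff q i

  open _≋_ public

  _⊕_ : List Carrier → List Carrier → List Carrier
  []      ⊕ q       = q
  (a ∷ p) ⊕ []      = a ∷ p
  (a ∷ p) ⊕ (b ∷ q) = a + b ∷ p ⊕ q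

  ⊖_ : List Carrier → List Carrier
  ⊖ p = map -_ p

  _⊙_ : Carrier → List Carrier → List Carrier
  a ⊙ p = map (a *_) p

  _⊛_ : List Carrier → List Carrier → List Carrier
  []      ⊛ q = []
  (a ∷ p) ⊛ q = a ⊙ q ⊕ (0# ∷ p ⊛ q)

  coeff-⊕ : ∀ p q i → coeff (p ⊕ q) i ≈ coeff p i + coeff q i
  coeff-⊕ []      q       i       = ≈-sym (+-identityˡ _)
  coeff-⊕ (a ∷ p) []      i       = ≈-sym (+-identityʳ _)
  coeff-⊕ (a ∷ p) (b ∷ q) zero    = ≈-refl
  coeff-⊕ (a ∷ p) (b ∷ q) (suc i) = coeff-⊕ p q i

  coeff-⊖ : ∀ p i → coeff (⊖ p) i ≈ - coeff p i
  coeff-⊖ []      i       = ≈-sym -0≈0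
    where open import Algebra.Properties.Ring ring renaming (-0#≈0# to -0≈0)
  coeff-⊖ (a ∷ p) zero    = ≈-refl
  coeff-⊖ (a ∷ p) (suc i) = coeff-⊖ p i

  coeff-⊙ : ∀ a p i → coeff (a ⊙ p) i ≈ a * coeff p i
  coeff-⊙ a []      i       = ≈-sym (zeroʳ a)
  coeff-⊙ a (b ∷ p) zero    = ≈-refl
  coeff-⊙ a (b ∷ p) (suc i) = coeff-⊙ a p i

  ⊕-abelianGroup : AbelianGroup 0ℓ 0ℓ
  ⊕-abelianGroup = record
    { Carrier = List Carrier
    ; _≈_ = _≋_
    ; _∙_ = _⊕_
    ; ε   = []
    ; _⁻¹ = ⊖_
    ; isAbelianGroup = record
      { isGroup = record
        { isMonoid = record
          { isSemigroup = record
            { isMagma = record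
              { isEquivalence = record
                { refl  = mk≋ λ i → ≈-refl
                ; sym   = λ e → mk≋ λ i → ≈-sym (at e i)
                ; trans = λ e f → mk≋ λ i → ≈-trans (at e i) (at f i)
                }
              ; ∙-cong = λ {p} {p′} {q} {q′} e f → mk≋ λ i →
                  ≈-trans (coeff-⊕ p q i)
                  (≈-trans (+-cong (at e i) (at f i)) (≈-sym (coeff-⊕ p′ q′ i)))
              }
            ; assoc = λ p q r → mk≋ λ i → let open ≈-Reasoning in begin
                coeff (p ⊕ q ⊕ r) i                  ≈⟨ coeff-⊕ (p ⊕ q) r i ⟩
                coeff (p ⊕ q) i + coeff r i          ≈⟨ +-congʳ (coeff-⊕ p q i) ⟩
                coeff p i + coeff q i + coeff r i    ≈⟨ +-assoc _ _ _ ⟩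
                coeff p i + (coeff q i + coeff r i)  ≈⟨ +-congˡ (coeff-⊕ q r i) ⟨
                coeff p i + coeff (q ⊕ r) i          ≈⟨ coeff-⊕ p (q ⊕ r) i ⟨
                coeff (p ⊕ (q ⊕ r)) i                ∎
            }
          ; identity = (λ p → mk≋ λ i → ≈-refl)
                     , (λ p → mk≋ λ i →
                          ≈-trans (coeff-⊕ p [] i) (+-identityʳ _))
          }
        ; inverse = (λ p → mk≋ λ i → ≈-trans (coeff-⊕ (⊖ p) p i)
                       (≈-trans (+-congʳ (coeff-⊖ p i)) (-‿inverseˡ _)))
                  , (λ p → mk≋ λ i → ≈-trans (coeff-⊕ p (⊖ p) i)
                       (≈-trans (+-congˡ (coeff-⊖ p i)) (-‿inverseʳ _)))
        ; ⁻¹-cong = λ {p} {q} e → mk≋ λ i → ≈-trans (coeff-⊖ p i)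
            (≈-trans (-‿cong (at e i)) (≈-sym (coeff-⊖ q i)))
        }
      ; comm = λ p q → mk≋ λ i → ≈-trans (coeff-⊕ p q i)
          (≈-trans (+-comm _ _) (≈-sym (coeff-⊕ q p i)))
      }
    }

  private module ⊕ = AbelianGroup ⊕-abelianGroup
  open AbelianGroup ⊕-abelianGroup using () renaming
    (refl to ≋-refl; sym to ≋-sym; trans to ≋-trans; ∙-cong to ⊕-cong)
  open CommutativeSemigroupProperties
    (CommutativeMonoid.commutativeSemigroup ⊕.commutativeMonoid)
    using (interchange; x∙yz≈y∙xz)
  private module ≋-Reasoning = SetoidReasoning ⊕.setoid

  ∷-cong : ∀ {a b p q} → a ≈ b → p ≋ q → a ∷ p ≋ b ∷ q
  at (∷-cong a≈b p≋q) zero    = a≈b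
  at (∷-cong a≈b p≋q) (suc i) = at p≋q i

  0∷[]≋[] : 0# ∷ [] ≋ []
  at 0∷[]≋[] zero    = ≈-refl
  at 0∷[]≋[] (suc i) = ≈-refl

  ∷≋[] : ∀ {a p} → a ≈ 0# → p ≋ [] → a ∷ p ≋ []
  ∷≋[] a≈0 p≋[] = ≋-trans (∷-cong a≈0 p≋[]) 0∷[]≋[]

  ∷≋[]-head : ∀ {a p} → a ∷ p ≋ [] → a ≈ 0#
  ∷≋[]-head e = at e 0

  ∷≋[]-tail : ∀ {a p} → a ∷ p ≋ [] → p ≋ []
  ∷≋[]-tail e = mk≋ λ i → at e (suc i)

  shift-⊕ : ∀ p q → 0# ∷ p ⊕ q ≋ (0# ∷ p) ⊕ (0# ∷ q)
  shift-⊕ p q = ∷-cong (≈-sym (+-identityˡ 0#)) ≋-refl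

  ⊙-cong : ∀ {a b p q} → a ≈ b → p ≋ q → a ⊙ p ≋ b ⊙ q
  ⊙-cong {a} {b} {p} {q} a≈b p≋q = mk≋ λ i → ≈-trans (coeff-⊙ a p i)
    (≈-trans (*-cong a≈b (at p≋q i)) (≈-sym (coeff-⊙ b q i)))

  ⊙-zeroˡ : ∀ p → 0# ⊙ p ≋ []
  ⊙-zeroˡ p = mk≋ λ i → ≈-trans (coeff-⊙ 0# p i) (zeroˡ _)

  ⊙-identityˡ : ∀ p → 1# ⊙ p ≋ p
  ⊙-identityˡ p = mk≋ λ i → ≈-trans (coeff-⊙ 1# p i) (*-identityˡ _)

  ⊙-distribˡ : ∀ a p q → a ⊙ (p ⊕ q) ≋ a ⊙ p ⊕ a ⊙ q
  ⊙-distribˡ a p q = mk≋ λ i → let open ≈-Reasoning in begin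
    coeff (a ⊙ (p ⊕ q)) i              ≈⟨ coeff-⊙ a (p ⊕ q) i ⟩
    a * coeff (p ⊕ q) i                ≈⟨ *-congˡ (coeff-⊕ p q i) ⟩
    a * (coeff p i + coeff q i)        ≈⟨ distribˡ a _ _ ⟩
    a * coeff p i + a * coeff q i      ≈⟨ +-cong (coeff-⊙ a p i) (coeff-⊙ a q i) ⟨
    coeff (a ⊙ p) i + coeff (a ⊙ q) i  ≈⟨ coeff-⊕ (a ⊙ p) (a ⊙ q) i ⟨
    coeff (a ⊙ p ⊕ a ⊙ q) i            ∎

  ⊙-distribʳ : ∀ a b p → (a + b) ⊙ p ≋ a ⊙ p ⊕ b ⊙ p
  ⊙-distribʳ a b p = mk≋ λ i → let open ≈-Reasoning in begin
    coeff ((a + b) ⊙ p) i              ≈⟨ coeff-⊙ (a + b) p i ⟩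
    (a + b) * coeff p i                ≈⟨ distribʳ _ a b ⟩
    a * coeff p i + b * coeff p i      ≈⟨ +-cong (coeff-⊙ a p i) (coeff-⊙ b p i) ⟨
    coeff (a ⊙ p) i + coeff (b ⊙ p) i  ≈⟨ coeff-⊕ (a ⊙ p) (b ⊙ p) i ⟨
    coeff (a ⊙ p ⊕ b ⊙ p) i            ∎

  ⊙-assoc : ∀ a b p → (a * b) ⊙ p ≋ a ⊙ (b ⊙ p)
  ⊙-assoc a b p = mk≋ λ i → let open ≈-Reasoning in begin
    coeff ((a * b) ⊙ p) i  ≈⟨ coeff-⊙ (a * b) p i ⟩
    a * b * coeff p i      ≈⟨ *-assoc a b _ ⟩
    a * (b * coeff p i)    ≈⟨ *-congˡ (coeff-⊙ b p i) ⟨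
    a * coeff (b ⊙ p) i    ≈⟨ coeff-⊙ a (b ⊙ p) i ⟨
    coeff (a ⊙ (b ⊙ p)) i  ∎

  ⊛-congˡ : ∀ p {q r} → q ≋ r → p ⊛ q ≋ p ⊛ r
  ⊛-congˡ []      q≋r = ≋-refl
  ⊛-congˡ (a ∷ p) q≋r =
    ⊕-cong (⊙-cong ≈-refl q≋r) (∷-cong ≈-refl (⊛-congˡ p q≋r))

  ⊛-zeroʳ : ∀ p → p ⊛ [] ≋ []
  ⊛-zeroʳ []      = ≋-refl
  ⊛-zeroʳ (a ∷ p) = ∷≋[] ≈-refl (⊛-zeroʳ p)

  ⊛-∷ʳ : ∀ p b q → p ⊛ (b ∷ q) ≋ b ⊙ p ⊕ (0# ∷ p ⊛ q)
  ⊛-∷ʳ []      b q = ≋-sym 0∷[]≋[]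
  ⊛-∷ʳ (a ∷ p) b q = ∷-cong (+-congʳ (*-comm a b)) (begin
    a ⊙ q ⊕ p ⊛ (b ∷ q)              ≈⟨ ⊕-cong ≋-refl (⊛-∷ʳ p b q) ⟩
    a ⊙ q ⊕ (b ⊙ p ⊕ (0# ∷ p ⊛ q))   ≈⟨ x∙yz≈y∙xz (a ⊙ q) (b ⊙ p) _ ⟩
    b ⊙ p ⊕ (a ⊙ q ⊕ (0# ∷ p ⊛ q))   ∎)
    where open ≋-Reasoning

  ⊛-comm : ∀ p q → p ⊛ q ≋ q ⊛ p
  ⊛-comm p []      = ⊛-zeroʳ p
  ⊛-comm p (b ∷ q) = ≋-trans (⊛-∷ʳ p b q)
    (⊕-cong (≋-refl {b ⊙ p}) (∷-cong ≈-refl (⊛-comm p q)))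

  ⊛-cong : ∀ {p p′ q q′} → p ≋ p′ → q ≋ q′ → p ⊛ q ≋ p′ ⊛ q′
  ⊛-cong {p} {p′} {q} {q′} p≋p′ q≋q′ = begin
    p ⊛ q    ≈⟨ ⊛-congˡ p q≋q′ ⟩
    p ⊛ q′   ≈⟨ ⊛-comm p q′ ⟩
    q′ ⊛ p   ≈⟨ ⊛-congˡ q′ p≋p′ ⟩
    q′ ⊛ p′  ≈⟨ ⊛-comm q′ p′ ⟩
    p′ ⊛ q′  ∎
    where open ≋-Reasoning

  ⊛-distribˡ : ∀ p q r → p ⊛ (q ⊕ r) ≋ p ⊛ q ⊕ p ⊛ r
  ⊛-distribˡ []      q r = ≋-refl
  ⊛-distribˡ (a ∷ p) q r = begin
    a ⊙ (q ⊕ r) ⊕ (0# ∷ p ⊛ (q ⊕ r))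
      ≈⟨ ⊕-cong (⊙-distribˡ a q r) (∷-cong ≈-refl (⊛-distribˡ p q r)) ⟩
    (a ⊙ q ⊕ a ⊙ r) ⊕ (0# ∷ p ⊛ q ⊕ p ⊛ r)
      ≈⟨ ⊕-cong ≋-refl (shift-⊕ (p ⊛ q) (p ⊛ r)) ⟩
    (a ⊙ q ⊕ a ⊙ r) ⊕ ((0# ∷ p ⊛ q) ⊕ (0# ∷ p ⊛ r))
      ≈⟨ interchange (a ⊙ q) (a ⊙ r) _ _ ⟩
    (a ⊙ q ⊕ (0# ∷ p ⊛ q)) ⊕ (a ⊙ r ⊕ (0# ∷ p ⊛ r)) ∎
    where open ≋-Reasoning

  ⊛-distribʳ : ∀ p q r → (q ⊕ r) ⊛ p ≋ q ⊛ p ⊕ r ⊛ p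
  ⊛-distribʳ p q r = ≋-trans (⊛-comm (q ⊕ r) p)
    (≋-trans (⊛-distribˡ p q r) (⊕-cong (⊛-comm p q) (⊛-comm p r)))

  ⊙-⊛ : ∀ a p q → (a ⊙ p) ⊛ q ≋ a ⊙ (p ⊛ q)
  ⊙-⊛ a []      q = ≋-refl
  ⊙-⊛ a (b ∷ p) q = begin
    (a * b) ⊙ q ⊕ (0# ∷ (a ⊙ p) ⊛ q)
      ≈⟨ ⊕-cong (⊙-assoc a b q) (∷-cong (≈-sym (zeroʳ a)) (⊙-⊛ a p q)) ⟩
    a ⊙ (b ⊙ q) ⊕ a ⊙ (0# ∷ p ⊛ q)
      ≈⟨ ⊙-distribˡ a (b ⊙ q) (0# ∷ p ⊛ q) ⟨
    a ⊙ (b ⊙ q ⊕ (0# ∷ p ⊛ q)) ∎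
    where open ≋-Reasoning

  ⊛-assoc : ∀ p q r → (p ⊛ q) ⊛ r ≋ p ⊛ (q ⊛ r)
  ⊛-assoc []      q r = ≋-refl
  ⊛-assoc (a ∷ p) q r = begin
    (a ⊙ q ⊕ (0# ∷ p ⊛ q)) ⊛ r
      ≈⟨ ⊛-distribʳ r (a ⊙ q) (0# ∷ p ⊛ q) ⟩
    (a ⊙ q) ⊛ r ⊕ (0# ⊙ r ⊕ (0# ∷ (p ⊛ q) ⊛ r))
      ≈⟨ ⊕-cong (⊙-⊛ a q r) (⊕-cong (⊙-zeroˡ r) (∷-cong ≈-refl (⊛-assoc p q r))) ⟩
    a ⊙ (q ⊛ r) ⊕ (0# ∷ p ⊛ (q ⊛ r)) ∎
    where open ≋-Reasoning

  ⊛-identityˡ : ∀ p → (1# ∷ []) ⊛ p ≋ p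
  ⊛-identityˡ p = begin
    1# ⊙ p ⊕ (0# ∷ [])  ≈⟨ ⊕-cong (⊙-identityˡ p) 0∷[]≋[] ⟩
    p ⊕ []              ≈⟨ ⊕.identityʳ p ⟩
    p                   ∎
    where open ≋-Reasoning

  polynomialRing : CommutativeRing 0ℓ 0ℓ
  polynomialRing = record
    { Carrier = List Carrier
    ; _≈_ = _≋_
    ; _+_ = _⊕_
    ; _*_ = _⊛_
    ; -_  = ⊖_
    ; 0#  = []
    ; 1#  = 1# ∷ []
    ; isCommutativeRing = record
      { isRing = record
        { +-isAbelianGroup = ⊕.isAbelianGroup
        ; *-cong     = ⊛-cong
        ; *-assoc    = ⊛-assoc
        ; *-identity = ⊛-identityˡ
                     , λ p → ≋-trans (⊛-comm p (1# ∷ [])) (⊛-identityˡ p)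
        ; distrib    = ⊛-distribˡ , ⊛-distribʳ
        }
      ; *-comm = ⊛-comm
      }
    }

  dropˡ : ∀ {a} p q → a ≈ 0# → (a ∷ p) ⊛ q ≋ [] → p ⊛ q ≋ []
  dropˡ {a} p q a≈0 apq≋0 = ∷≋[]-tail (begin
    0# ∷ p ⊛ q
      ≈⟨ ⊕-cong (≋-trans (⊙-cong a≈0 (≋-refl {q})) (⊙-zeroˡ q)) ≋-refl ⟨
    a ⊙ q ⊕ (0# ∷ p ⊛ q)
      ≈⟨ apq≋0 ⟩
    [] ∎)
    where open ≋-Reasoning

  dropʳ : ∀ {b} p q → b ≈ 0# → p ⊛ (b ∷ q) ≋ [] → p ⊛ q ≋ []
  dropʳ {b} p q b≈0 pbq≋0 = ≋-trans (⊛-comm p q)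
    (dropˡ q p b≈0 (≋-trans (⊛-comm (b ∷ q) p) pbq≋0))

  module _ (noZeroDivisors : ∀ x y → x * y ≈ 0# → x ≈ 0# ⊎ y ≈ 0#) where

    ⊛-noZeroDivisors : ∀ p q → p ⊛ q ≋ [] → p ≋ [] ⊎ q ≋ []
    ⊛-noZeroDivisors []      q       _    = inj₁ ≋-refl
    ⊛-noZeroDivisors (a ∷ p) []      _    = inj₂ ≋-refl
    ⊛-noZeroDivisors (a ∷ p) (b ∷ q) pq≋0 = Sum.[
      (λ a≈0 → Sum.map₁ (∷≋[] a≈0)
        (⊛-noZeroDivisors p (b ∷ q) (dropˡ p (b ∷ q) a≈0 pq≋0))) ,
      (λ b≈0 → Sum.map₂ (∷≋[] b≈0)
        (⊛-noZeroDivisors (a ∷ p) q (dropʳ (a ∷ p) q b≈0 pq≋0))) ]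
      (noZeroDivisors a b
        (≈-trans (≈-sym (+-identityʳ (a * b))) (∷≋[]-head pq≋0)))

polynomialDomain : IntegralDomain → IntegralDomain
polynomialDomain R = record
  { commutativeRing = polynomialRing
  ; 1≉0             = λ 1≋0 → R.1≉0 (at 1≋0 0)
  ; noZeroDivisors  = ⊛-noZeroDivisors R.noZeroDivisors
  }
  where
  module R = IntegralDomain R
  open Univariate R.commutativeRing

module Fractions (R : IntegralDomain) where
  open IntegralDomain R

  record Fraction : Set where
    constructor _over_[_]
    field
      num   : Carrier
      den   : Carrier
      den≉0 : ¬ den ≈ 0#

  *-nonzero : ∀ {x y} → ¬ x ≈ 0# → ¬ y ≈ 0# → ¬ x * y ≈ 0#
  *-nonzero {x} {y} x≉0 y≉0 xy≈0 = Sum.[ x≉0 , y≉0 ] (noZeroDivisors x y xy≈0)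

  embed : Carrier → Fraction
  embed a = a over 1# [ 1≉0 ]

  fractionRing : RawRing 0ℓ 0ℓ
  fractionRing = record
    { Carrier = Fraction
    ; _≈_ = λ { (a over b [ _ ]) (c over d [ _ ]) → a * d ≈ c * b }
    ; _+_ = λ { (a over b [ b≉0 ]) (c over d [ d≉0 ]) →
                (a * d + c * b) over (b * d) [ *-nonzero b≉0 d≉0 ] }
    ; _*_ = λ { (a over b [ b≉0 ]) (c over d [ d≉0 ]) →
                (a * c) over (b * d) [ *-nonzero b≉0 d≉0 ] }
    ; -_  = λ { (a over b [ b≉0 ]) → (- a) over b [ b≉0 ] }
    ; 0#  = embed 0#
    ; 1#  = embed 1#
    }

-- ℚ[x₁,…,xₖ], built as ℚ[x₂,…,xₖ][x₁]
ℚ[x_] : ℕ → IntegralDomain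
ℚ[x zero ]  = ℚ-domain
ℚ[x suc k ] = polynomialDomain ℚ[x k ]

constant : ∀ k → ℚ → IntegralDomain.Carrier ℚ[x k ]
constant zero    q = q
constant (suc k) q = constant k q ∷ []

variable-x : ∀ {k} → Fin k → IntegralDomain.Carrier ℚ[x k ]
variable-x {suc k} zero    = 0# ∷ 1# ∷ []
  where open IntegralDomain ℚ[x k ]
variable-x {suc k} (suc l) = variable-x l ∷ []

ℚ⟨x_⟩ : ℕ → RawRing 0ℓ 0ℓ
ℚ⟨x k ⟩ = Fractions.fractionRing ℚ[x k ]

genericMatrix : ∀ {k m n} → (Fin k → Matrix ℚ m n) →
                Matrix (RawRing.Carrier ℚ⟨x k ⟩) m n
genericMatrix {k} A i j =
  sum λ l → embed (constant k (A l i j)) * embed (variable-x l)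
  where
  open RawRing ℚ⟨x k ⟩
  open RawSemiringDefs rawSemiring using (sum)
  open Fractions ℚ[x k ] using (embed)

-- L is a subset of a field K, which contains ℚ via ι.
module Conjectures (K : RawRing 0ℓ 0ℓ) (ι : ℚ → RawRing.Carrier K)
                   (L : Pred (RawRing.Carrier K) 0ℓ) where
  open RawRing K
  open RawSemiringDefs rawSemiring using (sum)
  open Linear K

  LinearlyIndependentOverℚ : ∀ {k} → Vector Carrier k → Set
  LinearlyIndependentOverℚ {k} x =
    ∀ (c : Vector ℚ k) → (sum λ l → ι (c l) * x l) ≈ 0# → ∀ l → c l ≡ 0ℚ

  StructuralRankConjecture : Set
  StructuralRankConjecture =
    ∀ m n → 1 ℕ.≤ m → 1 ℕ.≤ n →
    ∀ (M : Matrix Carrier m n) → (∀ i j → L (M i j)) →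
    ∀ k (A : Fin k → Matrix ℚ m n) (x : Vector Carrier k) →
    (∀ l → L (x l)) → LinearlyIndependentOverℚ x →
    (∀ i j → M i j ≈ sum λ l → ι (A l i j) * x l) →
    ∃[ r ] HasRank M r × Linear.HasRank ℚ⟨x k ⟩ (genericMatrix A) r

  MatrixCoefficientConjecture : Set
  MatrixCoefficientConjecture =
    ∀ n → 1 ℕ.≤ n →
    ∀ (M : Matrix Carrier n n) → (∀ i j → L (M i j)) → det M ≈ 0# →
    ∃₂ λ (w v : Vector ℚ n) →
      (∃[ i ] w i ≢ 0ℚ) × (∃[ i ] v i ≢ 0ℚ) ×
      ⟨ ι ∘ w , M · (ι ∘ v) ⟩ ≈ 0#

{-# OPTIONS --safe #-}

-- Write M = Σ Aₗ λₗ over a ℚ-basis λ of the span of its entries, and let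
-- A(x) = Σ Aₗ xₗ.  If det M = 0 then M has rank < n, hence so has A(x), which
-- therefore has nonzero polynomial kernel vectors: A(x) v(x) = 0 and
-- w(x)ᵀ A(x) = 0.  Differentiating the first equation in the direction λ gives
-- M v + A(x) (∂v) = 0, and multiplying by w(x)ᵀ on the left gives
-- w(x)ᵀ M v(x) = 0.  Specialise x to a rational point where w and v are nonzero.

module Submission where

open import Defs
open import Level using (0ℓ)
open import Algebra.Bundles using (RawRing; CommutativeRing)
import Algebra.Definitions.RawSemiring as RawSemiringDefs
open import Algebra.Morphism.Structures using (module RingMorphisms)
import Algebra.Properties.Ring as RingProperties
import Algebra.Properties.Semiring.Sum as SemiringSum
import Algebra.Solver.Ring.NaturalCoefficients.Default as SemiringSolver
open import Axiom.ExcludedMiddle using (ExcludedMiddle)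
open import Data.Empty using (⊥-elim)
open import Data.Fin.Base as Fin
  using (Fin; zero; suc; toℕ; punchIn; punchOut; pinch; combine; remQuot)
import Data.Fin.Properties as Fin
open import Data.List.Base using (List; []; _∷_; map)
open import Data.List.Relation.Unary.Any using (Any; here; there; any?)
open import Data.Nat.Base as ℕ using (ℕ; zero; suc; s≤s)
import Data.Nat.Properties as ℕ
open import Data.Nat.Primality using (Prime)
open import Data.Product.Base using (_×_; _,_; ∃-syntax; ∃₂; proj₁; proj₂)
open import Data.Rational.Base using (ℚ; 0ℚ; 1ℚ; ½; ∣_∣)
import Data.Rational.Base as ℚ
import Data.Rational.Properties as ℚ
open import Data.Rational.Solver using (module +-*-Solver)
open import Data.Sum.Base as Sum using (_⊎_; inj₁; inj₂)
open import Data.Vec.Functional as Vector using (Vector; insertAt)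
open import Data.Vec.Functional.Properties using (insertAt-lookup; insertAt-punchIn)
open import Function.Base using (_∘_; id)
open import Function.Bundles using (module Equivalence)
open import Relation.Binary.PropositionalEquality as ≡ using (_≡_; _≢_)
import Relation.Binary.Reasoning.Setoid as SetoidReasoning
open import Relation.Nullary.Decidable using (¬?)
open import Relation.Nullary.Decidable.Core using (yes; no)
open import Relation.Nullary.Negation using (¬_)
open import Relation.Unary using (Pred)

-- Determinants and kernels over a domain

-- No derivation of polynomials is defined. Evaluation along the line α + tλ in K[t] followed by
-- reading off the coefficient of t has the same effect, and needs only that evaluation is a ring
-- homomorphism. The base point α is rational, so the constant terms are the rational values at α,
-- while λ enters only through t. M appears as a derivative because the entries of A(x) are linear
-- forms, and the derivative of a linear form in the direction λ is its value at λ. A single point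
-- has to serve both vectors: α is chosen off the zeros of the product of one nonzero entry of w(x)
-- and one nonzero entry of v(x). The linear algebra is done over an arbitrary integral domain and
-- without division, so that it applies alike to K, to the polynomial ring and to its fraction
-- field. Vanishing in these domains is decided by excluded middle.

-- A pair `j`, `k` encodes the ordered pair of distinct indices `j`, `punchIn j k`. The pair
-- `punchIn j k`, `pinch k j` encodes the same two indices in the opposite order.
punchIn-pinch : ∀ {n} (j : Fin (suc n)) (k : Fin n) →
                punchIn (punchIn j k) (pinch k j) ≡ j
punchIn-pinch {suc n} zero    k       = ≡.refl
punchIn-pinch         (suc j) zero    = ≡.refl
punchIn-pinch         (suc j) (suc k) = ≡.cong suc (punchIn-pinch j k)

-- Both sides enumerate, in increasing order, the indices outside the same two: the order of the two
-- deletions is irrelevant.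
punchIn-punchIn : ∀ {n} (j : Fin (suc (suc n))) (k : Fin (suc n)) (l : Fin n) →
                  punchIn (punchIn j k) (punchIn (pinch k j) l) ≡
                  punchIn j (punchIn k l)
punchIn-punchIn zero    k       l       = ≡.refl
punchIn-punchIn (suc j) zero    l       = ≡.refl
punchIn-punchIn (suc j) (suc k) zero    = ≡.refl
punchIn-punchIn (suc j) (suc k) (suc l) = ≡.cong suc (punchIn-punchIn j k l)

module Sums (R : CommutativeRing 0ℓ 0ℓ) where
  open CommutativeRing R hiding (zero)
  open RawSemiringDefs (RawRing.rawSemiring rawRing) using (sum)
  open RingProperties ring public using
    (-0#≈0#; -1*x≈-x; -‿distribˡ-*; -‿involutive; +-inverseˡ-unique)
  open SetoidReasoning setoid
  private module ∑ˢ = SemiringSum semiring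

  opaque
    -- sum, prevented from unfolding so that its argument can be inferred.
    ∑ : ∀ {n} → Vector Carrier n → Carrier
    ∑ = sum

    ∑≡sum : ∀ {n} (f : Vector Carrier n) → ∑ f ≡ sum f
    ∑≡sum f = ≡.refl

    ∑-empty : ∀ {f} → ∑ {zero} f ≈ 0#
    ∑-empty = refl

    ∑-suc : ∀ {n} {f : Vector Carrier (suc n)} → ∑ f ≈ f zero + ∑ (f ∘ suc)
    ∑-suc = refl

    ∑-cong : ∀ {n} {f g : Vector Carrier n} → (∀ i → f i ≈ g i) → ∑ f ≈ ∑ g
    ∑-cong = ∑ˢ.sum-cong-≋

    ∑-+ : ∀ {n} {f g : Vector Carrier n} → ∑ (λ i → f i + g i) ≈ ∑ f + ∑ g
    ∑-+ {f = f} {g} = ∑ˢ.∑-distrib-+ f g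

    ∑-comm : ∀ {m n} {f : Matrix Carrier m n} →
             ∑ (λ i → ∑ (f i)) ≈ ∑ (λ j → ∑ (λ i → f i j))
    ∑-comm {f = f} = ∑ˢ.∑-comm f

    *-∑ : ∀ {n a} {f : Vector Carrier n} → a * ∑ f ≈ ∑ (λ i → a * f i)
    *-∑ {a = a} {f} = ∑ˢ.*-distribˡ-sum a f

    ∑-* : ∀ {n a} {f : Vector Carrier n} → ∑ f * a ≈ ∑ (λ i → f i * a)
    ∑-* {a = a} {f} = ∑ˢ.*-distribʳ-sum a f

    ∑-remove : ∀ {n} (i : Fin (suc n)) {f : Vector Carrier (suc n)} →
               ∑ f ≈ f i + ∑ (f ∘ punchIn i)
    ∑-remove i {f} = ∑ˢ.sum-remove f

  ∑-zero : ∀ {n} {f : Vector Carrier n} → (∀ i → f i ≈ 0#) → ∑ f ≈ 0#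
  ∑-zero {zero}  f≈0 = ∑-empty
  ∑-zero {suc n} f≈0 =
    trans ∑-suc (trans (+-cong (f≈0 zero) (∑-zero (f≈0 ∘ suc))) (+-identityˡ 0#))

  *≈0ˡ : ∀ {x y} → x ≈ 0# → x * y ≈ 0#
  *≈0ˡ x≈0 = trans (*-congʳ x≈0) (zeroˡ _)

  *≈0ʳ : ∀ {x y} → y ≈ 0# → x * y ≈ 0#
  *≈0ʳ y≈0 = trans (*-congˡ y≈0) (zeroʳ _)

  indicator : ∀ {n} → Fin n → Vector Carrier n
  indicator zero    zero    = 1#
  indicator zero    (suc l) = 0#
  indicator (suc k) zero    = 0#
  indicator (suc k) (suc l) = indicator k l

  ∑-indicator : ∀ {n} (k : Fin n) {f : Vector Carrier n} → ∑ (λ l → indicator k l * f l) ≈ f k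
  ∑-indicator zero {f} = begin
    ∑ (λ l → indicator zero l * f l)           ≈⟨ ∑-suc ⟩
    1# * f zero + ∑ (λ l → 0# * f (suc l))
      ≈⟨ +-cong (*-identityˡ _) (∑-zero (λ _ → zeroˡ _)) ⟩
    f zero + 0#                                ≈⟨ +-identityʳ _ ⟩
    f zero                                     ∎
  ∑-indicator (suc k) {f} = begin
    ∑ (λ l → indicator (suc k) l * f l)                ≈⟨ ∑-suc ⟩
    0# * f zero + ∑ (λ l → indicator k l * f (suc l))
      ≈⟨ +-cong (zeroˡ _) (∑-indicator k) ⟩
    0# + f (suc k)                                     ≈⟨ +-identityˡ _ ⟩
    f (suc k)                                          ∎

  ∑-assoc : ∀ {m n} {f : Vector Carrier m} {g : Matrix Carrier m n} {h : Vector Carrier n} →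
            ∑ (λ i → f i * ∑ (λ j → g i j * h j)) ≈
            ∑ (λ j → ∑ (λ i → f i * g i j) * h j)
  ∑-assoc {f = f} {g} {h} = begin
    ∑ (λ i → f i * ∑ (λ j → g i j * h j))      ≈⟨ ∑-cong (λ i → *-∑) ⟩
    ∑ (λ i → ∑ (λ j → f i * (g i j * h j)))    ≈⟨ ∑-comm ⟩
    ∑ (λ j → ∑ (λ i → f i * (g i j * h j)))
      ≈⟨ ∑-cong (λ j → ∑-cong λ i → *-assoc _ _ _) ⟨
    ∑ (λ j → ∑ (λ i → f i * g i j * h j))      ≈⟨ ∑-cong (λ j → ∑-*) ⟨
    ∑ (λ j → ∑ (λ i → f i * g i j) * h j)      ∎

module Determinant (R : CommutativeRing 0ℓ 0ℓ) where
  open CommutativeRing R hiding (zero)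
  open RawSemiringDefs (RawRing.rawSemiring rawRing) using (_^_)
  open Linear rawRing
  open Sums R
  open SetoidReasoning setoid
  open SemiringSolver commutativeSemiring using (solve; _:+_; _:*_; _:=_)

  sign : ∀ {n} → Fin n → Carrier
  sign j = (- 1#) ^ toℕ j

  minors : ∀ {n} → Matrix Carrier n (suc n) → Vector Carrier (suc n)
  minors N j = det λ i l → N i (punchIn j l)

  det-suc : ∀ {n} (M : Matrix Carrier (suc n) (suc n)) →
            det M ≈ ∑ (λ j → sign j * (M zero j * minors (M ∘ suc) j))
  det-suc M = sym (reflexive (∑≡sum _))

  det-cong : ∀ {n} {M N : Matrix Carrier n n} →
             (∀ i j → M i j ≈ N i j) → det M ≈ det N
  det-cong {zero}  M≈N = refl
  det-cong {suc n} {M} {N} M≈N = begin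
    det M                                      ≈⟨ det-suc M ⟩
    ∑ (λ j → sign j * (M zero j * minors (M ∘ suc) j))
      ≈⟨ ∑-cong (λ j → *-congˡ (*-cong (M≈N zero j)
           (det-cong λ i l → M≈N (suc i) (punchIn j l)))) ⟩
    ∑ (λ j → sign j * (N zero j * minors (N ∘ suc) j))
                                               ≈⟨ det-suc N ⟨
    det N                                      ∎

  -- The sum runs over ordered pairs of distinct indices, and exchanging the two cancels each term
  -- against another. The induction pairs the terms with first index zero with those whose second
  -- index is zero. Nothing is divided by 2, so the characteristic does not matter.
  antisymmetric-∑ : ∀ {n} (G : Fin (suc n) → Fin n → Carrier) →
    (∀ j k → G j k + G (punchIn j k) (pinch k j) ≈ 0#) →
    ∑ (λ j → ∑ (G j)) ≈ 0#
  antisymmetric-∑ {zero}  G anti = ∑-zero λ j → ∑-empty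
  antisymmetric-∑ {suc n} G anti = begin
    ∑ (λ j → ∑ (G j))  ≈⟨ ∑-suc ⟩
    ∑ (G zero) + ∑ (λ j → ∑ (G (suc j)))
      ≈⟨ +-congˡ (∑-cong λ j → ∑-suc) ⟩
    ∑ (G zero) + ∑ (λ j → G (suc j) zero + ∑ (λ k → G (suc j) (suc k)))
      ≈⟨ +-congˡ ∑-+ ⟩
    ∑ (G zero) + (∑ (λ j → G (suc j) zero) +
                  ∑ (λ j → ∑ (λ k → G (suc j) (suc k))))
      ≈⟨ +-congˡ (+-congˡ (antisymmetric-∑ (λ j k → G (suc j) (suc k))
                             (λ j k → anti (suc j) (suc k)))) ⟩
    ∑ (G zero) + (∑ (λ j → G (suc j) zero) + 0#)  ≈⟨ +-congˡ (+-identityʳ _) ⟩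
    ∑ (G zero) + ∑ (λ j → G (suc j) zero)         ≈⟨ ∑-+ ⟨
    ∑ (λ k → G zero k + G (suc k) zero)           ≈⟨ ∑-zero (anti zero) ⟩
    0# ∎

  -- Exchanging the two indices changes the sum of the two positions by exactly one, since only the
  -- larger index is shifted when the smaller is deleted first.
  sign-anti : ∀ {n} (j : Fin (suc n)) (k : Fin n) →
              sign j * sign k + sign (punchIn j k) * sign (pinch k j) ≈ 0#
  sign-anti {suc n} zero k = begin
    1# * sign k + - 1# * sign k * 1#  ≈⟨ +-congˡ (*-identityʳ _) ⟩
    1# * sign k + - 1# * sign k       ≈⟨ distribʳ (sign k) 1# (- 1#) ⟨
    (1# - 1#) * sign k                ≈⟨ *≈0ˡ (-‿inverseʳ 1#) ⟩
    0#                                ∎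
  sign-anti (suc j) zero = begin
    - 1# * sign j * 1# + 1# * sign j  ≈⟨ +-congʳ (*-identityʳ _) ⟩
    - 1# * sign j + 1# * sign j       ≈⟨ distribʳ (sign j) (- 1#) 1# ⟨
    (- 1# + 1#) * sign j              ≈⟨ *≈0ˡ (-‿inverseˡ 1#) ⟩
    0#                                ∎
  sign-anti (suc j) (suc k) = begin
    - 1# * a * (- 1# * b) + - 1# * c * (- 1# * d)
      ≈⟨ solve 5 (λ m a b c d →
           m :* a :* (m :* b) :+ m :* c :* (m :* d) :=
           m :* m :* (a :* b :+ c :* d)) refl (- 1#) a b c d ⟩
    - 1# * - 1# * (a * b + c * d)
      ≈⟨ *≈0ʳ (sign-anti j k) ⟩
    0# ∎
    where
    a = sign j
    b = sign k
    c = sign (punchIn j k)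
    d = sign (pinch k j)

  -- Expanding a determinant with first rows a and b along both gives the
  -- double sum of these terms, D being the minors of the other rows.
  module _ {n} (D : Fin (suc n) → Fin n → Carrier)
           (D-symmetric : ∀ j k → D (punchIn j k) (pinch k j) ≈ D j k) where

    term : (a b : Vector Carrier (suc n)) → Fin (suc n) → Fin n → Carrier
    term a b j k = sign j * (a j * (sign k * (b (punchIn j k) * D j k)))

    term-anti : ∀ a b j k → term a b j k + term b a (punchIn j k) (pinch k j) ≈ 0#
    term-anti a b j k = begin
      term a b j k + term b a j′ k′
        ≈⟨ +-congˡ (*-congˡ (*-congˡ (*-congˡ (*-cong
             (reflexive (≡.cong a (punchIn-pinch j k))) (D-symmetric j k))))) ⟩
      term a b j k + sign j′ * (b j′ * (sign k′ * (a j * D j k)))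
        ≈⟨ solve 7 (λ s t s′ t′ x y d →
             s :* (x :* (t :* (y :* d))) :+ s′ :* (y :* (t′ :* (x :* d))) :=
             (s :* t :+ s′ :* t′) :* (x :* (y :* d))) refl
             (sign j) (sign k) (sign j′) (sign k′) (a j) (b j′) (D j k) ⟩
      (sign j * sign k + sign j′ * sign k′) * (a j * (b j′ * D j k))
        ≈⟨ *≈0ˡ (sign-anti j k) ⟩
      0# ∎
      where
      j′ = punchIn j k
      k′ = pinch k j

    expansion : (a b : Vector Carrier (suc n)) → Carrier
    expansion a b = ∑ λ j → ∑ (term a b j)

    -- The expansion is alternating in its two rows. `term-anti` matches terms of `term a b` with
    -- terms of `term b a`, so it is the sum of the two that is antisymmetric in the pair of
    -- columns.
    expansion-swap : ∀ a b → expansion b a ≈ 0# → expansion a b ≈ 0#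
    expansion-swap a b ba≈0 = begin
      expansion a b                  ≈⟨ +-identityʳ _ ⟨
      expansion a b + 0#             ≈⟨ +-congˡ ba≈0 ⟨
      expansion a b + expansion b a
        ≈⟨ trans (∑-cong λ j → ∑-+) ∑-+ ⟨
      ∑ (λ j → ∑ (λ k → term a b j k + term b a j k))
        ≈⟨ antisymmetric-∑ _ anti ⟩
      0# ∎
      where
      anti : ∀ j k → (term a b j k + term b a j k) +
                     (term a b (punchIn j k) (pinch k j) +
                      term b a (punchIn j k) (pinch k j)) ≈ 0#
      anti j k = begin
        (p + q) + (r + s)
          ≈⟨ solve 4 (λ p q r s → (p :+ q) :+ (r :+ s) := (p :+ s) :+ (q :+ r))
               refl p q r s ⟩
        (p + s) + (q + r)
          ≈⟨ +-cong (term-anti a b j k) (term-anti b a j k) ⟩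
        0# + 0#  ≈⟨ +-identityˡ 0# ⟩
        0#       ∎
        where
        p = term a b j k
        q = term b a j k
        r = term a b (punchIn j k) (pinch k j)
        s = term b a (punchIn j k) (pinch k j)

  -- The left side is the determinant of `N` with a copy of its row `i` put on top. If that row is
  -- the first of `N`, the double expansion is antisymmetric. Otherwise the top two rows are
  -- exchanged, and each inner sum is then the same statement for the remaining rows with one column
  -- deleted.
  det-repeatedRow : ∀ {n} (N : Matrix Carrier n (suc n)) i →
                    ∑ (λ j → sign j * (N i j * minors N j)) ≈ 0#
  det-repeatedRow {suc n} N i = begin
    ∑ (λ j → sign j * (N i j * minors N j))
      ≈⟨ ∑-cong (λ j → trans (*-congˡ (trans (*-congˡ (det-suc λ i l → N i (punchIn j l))) *-∑)) *-∑) ⟩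
    expansion D D-symmetric (N i) (N zero)
      ≈⟨ vanishes i ⟩
    0# ∎
    where
    D : Fin (suc (suc n)) → Fin (suc n) → Carrier
    D j k = det λ i l → N (suc i) (punchIn j (punchIn k l))
    D-symmetric : ∀ j k → D (punchIn j k) (pinch k j) ≈ D j k
    D-symmetric j k =
      det-cong λ i l → reflexive (≡.cong (N (suc i)) (punchIn-punchIn j k l))
    vanishes : ∀ i → expansion D D-symmetric (N i) (N zero) ≈ 0#
    vanishes zero    =
      antisymmetric-∑ _ (term-anti D D-symmetric (N zero) (N zero))
    vanishes (suc i) =
      expansion-swap D D-symmetric (N (suc i)) (N zero) (∑-zero λ j → begin
        ∑ (term D D-symmetric (N zero) (N (suc i)) j)
          ≈⟨ trans (*-congˡ *-∑) *-∑ ⟨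
        sign j * (N zero j * ∑ (λ k →
          sign k * (N (suc i) (punchIn j k) * D j k)))
          ≈⟨ *≈0ʳ (*≈0ʳ (det-repeatedRow (λ i l → N (suc i) (punchIn j l)) i)) ⟩
        0# ∎)

module LinearAlgebra (em : ExcludedMiddle 0ℓ) (R : IntegralDomain) where
  open IntegralDomain R hiding (zero)
  open Linear rawRing
  open Sums commutativeRing
  open Determinant commutativeRing
  open SetoidReasoning setoid
  open SemiringSolver commutativeSemiring using (solve; _:+_; _:*_; _:=_)

  Nonzero : ∀ {n} → Vector Carrier n → Set
  Nonzero u = ∃[ j ] ¬ u j ≈ 0#

  Kernel : ∀ {m n} → Matrix Carrier m n → Vector Carrier n → Set
  Kernel M u = ∀ i → ∑ (λ j → M i j * u j) ≈ 0#

  Singular : ∀ {m n} → Matrix Carrier m n → Set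
  Singular M = ∃[ u ] Nonzero u × Kernel M u

  cancelˡ : ∀ {x y} → ¬ x ≈ 0# → x * y ≈ 0# → y ≈ 0#
  cancelˡ {x} {y} x≉0 xy≈0 with noZeroDivisors x y xy≈0
  ... | inj₁ x≈0 = ⊥-elim (x≉0 x≈0)
  ... | inj₂ y≈0 = y≈0

  ∑-linear : ∀ {n} {a u v : Vector Carrier n} {β γ} →
             ∑ (λ l → a l * (β * u l + γ * v l)) ≈
             β * ∑ (λ l → a l * u l) + γ * ∑ (λ l → a l * v l)
  ∑-linear {a = a} {u} {v} {β} {γ} = begin
    ∑ (λ l → a l * (β * u l + γ * v l))
      ≈⟨ ∑-cong (λ l → solve 5 (λ a b c u v →
           a :* (b :* u :+ c :* v) := b :* (a :* u) :+ c :* (a :* v))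
           refl (a l) β γ (u l) (v l)) ⟩
    ∑ (λ l → β * (a l * u l) + γ * (a l * v l))  ≈⟨ ∑-+ ⟩
    ∑ (λ l → β * (a l * u l)) + ∑ (λ l → γ * (a l * v l))
      ≈⟨ +-cong *-∑ *-∑ ⟨
    β * ∑ (λ l → a l * u l) + γ * ∑ (λ l → a l * v l) ∎

  ∑-insertAt : ∀ {n} {a : Vector Carrier (suc n)} j (v : Vector Carrier n) →
               ∑ (λ l → a l * insertAt v j 0# l) ≈ ∑ (λ l → a (punchIn j l) * v l)
  ∑-insertAt {a = a} j v = begin
    ∑ (λ l → a l * insertAt v j 0# l)  ≈⟨ ∑-remove j ⟩
    a j * insertAt v j 0# j + ∑ (λ l → a (punchIn j l) * insertAt v j 0# (punchIn j l))
      ≈⟨ +-cong (*≈0ʳ (reflexive (insertAt-lookup v j 0#)))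
                (∑-cong λ l → *-congˡ (reflexive (insertAt-punchIn v j 0# l))) ⟩
    0# + ∑ (λ l → a (punchIn j l) * v l)  ≈⟨ +-identityˡ _ ⟩
    ∑ (λ l → a (punchIn j l) * v l)       ∎

  -- Two independent kernel vectors of the lower rows have a combination
  -- orthogonal to the first row: u with u₀ = 0 and uⱼ ≠ 0, and v with vⱼ = 0.
  singular-cons : ∀ {m n} (M : Matrix Carrier (suc m) (suc n)) →
    (∀ j → Singular λ i l → M (suc i) (punchIn j l)) → Singular M
  singular-cons {m} {n} M lower
    with u′ , (k , u′k≉0) , ker-u′ ← lower zero
    with v′ , (k′ , v′k≉0) , ker-v′ ← lower (suc k)
    with em {P = ∑ (λ l → M zero l * insertAt u′ zero 0# l) ≈ 0#}
       | em {P = ∑ (λ l → M zero l * insertAt v′ (suc k) 0# l) ≈ 0#}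
  ... | yes α≈0 | _ = insertAt u′ zero 0# , (suc k , u′k≉0) , λ
    { zero    → α≈0
    ; (suc i) → trans (∑-insertAt zero u′) (ker-u′ i)
    }
  ... | no _ | yes β≈0 = insertAt v′ (suc k) 0# , (punchIn (suc k) k′ , v≉0) , λ
    { zero    → β≈0
    ; (suc i) → trans (∑-insertAt (suc k) v′) (ker-v′ i)
    }
    where
    v≉0 : ¬ insertAt v′ (suc k) 0# (punchIn (suc k) k′) ≈ 0#
    v≉0 e = v′k≉0 (trans (sym (reflexive (insertAt-punchIn v′ (suc k) 0# k′))) e)
  ... | no α≉0 | no β≉0 =
    (λ l → β * u l + - α * v l) , (suc k , nonzero) , kernel
    where
    u v : Vector Carrier (suc n)
    u = insertAt u′ zero 0#
    v = insertAt v′ (suc k) 0#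
    α = ∑ (λ l → M zero l * u l)
    β = ∑ (λ l → M zero l * v l)
    nonzero : ¬ β * u (suc k) + - α * v (suc k) ≈ 0#
    nonzero e = u′k≉0 (cancelˡ β≉0 (begin
      β * u (suc k)                    ≈⟨ +-identityʳ _ ⟨
      β * u (suc k) + 0#
        ≈⟨ +-congˡ (*≈0ʳ (reflexive (insertAt-lookup v′ (suc k) 0#))) ⟨
      β * u (suc k) + - α * v (suc k)  ≈⟨ e ⟩
      0#                               ∎))
    kernel : Kernel M λ l → β * u l + - α * v l
    kernel zero = begin
      ∑ (λ l → M zero l * (β * u l + - α * v l))  ≈⟨ ∑-linear ⟩
      β * α + - α * β          ≈⟨ +-congʳ (*-comm β α) ⟩
      α * β + - α * β          ≈⟨ distribʳ β α (- α) ⟨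
      (α - α) * β              ≈⟨ *≈0ˡ (-‿inverseʳ α) ⟩
      0#                       ∎
    kernel (suc i) = begin
      ∑ (λ l → M (suc i) l * (β * u l + - α * v l))  ≈⟨ ∑-linear ⟩
      β * ∑ (λ l → M (suc i) l * u l) + - α * ∑ (λ l → M (suc i) l * v l)
        ≈⟨ +-cong (*≈0ʳ (trans (∑-insertAt zero u′) (ker-u′ i)))
                  (*≈0ʳ (trans (∑-insertAt (suc k) v′) (ker-v′ i))) ⟩
      0# + 0#  ≈⟨ +-identityˡ 0# ⟩
      0#       ∎

  -- Removing one row and any one column keeps the matrix wide, so `singular-cons` carries the
  -- induction on the rows without pivots.
  wide-singular : ∀ {m n} → m ℕ.< n → (M : Matrix Carrier m n) → Singular M
  wide-singular {zero}  {suc n} _ M = (λ _ → 1#) , (zero , 1≉0) , λ ()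
  wide-singular {suc m} {suc n} (s≤s m<n) M =
    singular-cons M λ j → wide-singular m<n λ i l → M (suc i) (punchIn j l)

  -- The cofactors of the first row form a kernel vector: the first row pairs with them to `det M`,
  -- every other row to a determinant with a repeated row. If all cofactors vanish, the minors are
  -- zero determinants of smaller size, hence singular by induction, and `singular-cons` applies.
  det≈0⇒singular : ∀ {n} (M : Matrix Carrier n n) → det M ≈ 0# → Singular M
  det≈0⇒singular {zero}  M det≈0 = ⊥-elim (1≉0 det≈0)
  det≈0⇒singular {suc n} M det≈0
    with em {P = ∃[ j ] ¬ sign j * minors (M ∘ suc) j ≈ 0#}
  ... | yes nonzero = _ , nonzero , λ
    { zero    → trans (∑-cong λ j → x∙yz≈y∙xz)
                      (trans (sym (det-suc M)) det≈0)
    ; (suc i) → trans (∑-cong λ j → x∙yz≈y∙xz) (det-repeatedRow (M ∘ suc) i)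
    }
    where
    x∙yz≈y∙xz : ∀ {x y z} → x * (y * z) ≈ y * (x * z)
    x∙yz≈y∙xz {x} {y} {z} =
      solve 3 (λ x y z → x :* (y :* z) := y :* (x :* z)) refl x y z
  ... | no none = singular-cons M λ j → det≈0⇒singular _ (minor≈0 j)
    where
    sign≉0 : ∀ {n} (j : Fin n) → ¬ sign j ≈ 0#
    sign≉0 zero    = 1≉0
    sign≉0 (suc j) e = sign≉0 j (begin
      sign j                     ≈⟨ -‿involutive _ ⟨
      - - sign j                 ≈⟨ -‿cong (-1*x≈-x (sign j)) ⟨
      - (- 1# * sign j)          ≈⟨ -‿cong e ⟩
      - 0#                       ≈⟨ -0#≈0# ⟩
      0#                         ∎)
    minor≈0 : ∀ j → minors (M ∘ suc) j ≈ 0#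
    minor≈0 j with em {P = minors (M ∘ suc) j ≈ 0#}
    ... | yes e = e
    ... | no ne = ⊥-elim (none (j , λ e → ne (cancelˡ (sign≉0 j) e)))

  opaque
    unfolding ∑

    combination-∑ : ∀ {m r} (c : Vector Carrier r) (b : Fin r → Vector Carrier m) i →
                    combination c b i ≈ ∑ (λ l → c l * b l i)
    combination-∑ c b i = refl

  member : ∀ {m r} (b : Fin r → Vector Carrier m) l → InSpan b (b l)
  member b l = indicator l , λ i →
    sym (trans (combination-∑ (indicator l) b i) (∑-indicator l))

  -- Each basis vector of the column space is a combination of columns; a kernel
  -- vector u with uⱼ ≠ 0 makes the j-th column redundant, up to the factor uⱼ.
  singular⇒rank< : ∀ {n} (M : Matrix Carrier n n) {r} →
                   Singular M → HasRank M r → r ℕ.< n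
  singular⇒rank< {suc n} M {r} (u , (j , uj≉0) , ker-u) (b , independent , span)
    with suc n ℕ.≤? r
  ... | no  n≰r = ℕ.≰⇒> n≰r
  ... | yes n<r = ⊥-elim (z≉0 (independent z zb≈0 k))
    where
    C : Fin r → Vector Carrier (suc n)
    C l = proj₁ (Equivalence.to (span (b l)) (member b l))
    b≈MC : ∀ l i → b l i ≈ ∑ (λ j′ → C l j′ * M i j′)
    b≈MC l i = trans (proj₂ (Equivalence.to (span (b l)) (member b l)) i)
                     (combination-∑ (C l) (columns M) i)
    -- Column `l` holds `C l` modulo `u`, with coordinate `j` eliminated. This leaves n coordinates
    -- for more than n vectors, so some nontrivial combination `y` of the `C l` is proportional to
    -- `u` and is therefore annihilated by `M`.
    wide = wide-singular n<r λ i l →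
             u j * C l (punchIn j i) + - u (punchIn j i) * C l j
    z = proj₁ wide
    k = proj₁ (proj₁ (proj₂ wide))
    z≉0 = proj₂ (proj₁ (proj₂ wide))
    y : Vector Carrier (suc n)
    y j′ = ∑ (λ l → z l * C l j′)
    y-off : ∀ i → u j * y (punchIn j i) + - u (punchIn j i) * y j ≈ 0#
    y-off i = trans (sym ∑-linear)
                    (trans (∑-cong λ l → *-comm _ _) (proj₂ (proj₂ wide) i))
    y∝u : ∀ j′ → u j * y j′ ≈ y j * u j′
    y∝u j′ with j Fin.≟ j′
    ... | yes ≡.refl = *-comm _ _
    ... | no  j≢j′ = begin
      u j * y j′              ≈⟨ +-inverseˡ-unique _ _
                                   (≡.subst (λ j′ → u j * y j′ + - u j′ * y j ≈ 0#)
                                      (Fin.punchIn-punchOut j≢j′) (y-off (punchOut j≢j′))) ⟩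
      - (- u j′ * y j)        ≈⟨ -‿cong (-‿distribˡ-* _ _) ⟨
      - - (u j′ * y j)        ≈⟨ -‿involutive _ ⟩
      u j′ * y j              ≈⟨ *-comm _ _ ⟩
      y j * u j′              ∎
    zb≈0 : ∀ i → combination z b i ≈ 0#
    zb≈0 i = cancelˡ uj≉0 (begin
      u j * combination z b i
        ≈⟨ *-congˡ (combination-∑ z b i) ⟩
      u j * ∑ (λ l → z l * b l i)
        ≈⟨ *-congˡ (∑-cong λ l → *-congˡ (b≈MC l i)) ⟩
      u j * ∑ (λ l → z l * ∑ (λ j′ → C l j′ * M i j′))
        ≈⟨ *-congˡ ∑-assoc ⟩
      u j * ∑ (λ j′ → y j′ * M i j′)
        ≈⟨ *-∑ ⟩
      ∑ (λ j′ → u j * (y j′ * M i j′))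
        ≈⟨ ∑-cong (λ j′ → trans (sym (*-assoc _ _ _))
             (trans (*-congʳ (y∝u j′)) (trans (*-assoc _ _ _) (*-congˡ (*-comm _ _))))) ⟩
      ∑ (λ j′ → y j * (M i j′ * u j′))
        ≈⟨ *-∑ ⟨
      y j * ∑ (λ j′ → M i j′ * u j′)
        ≈⟨ *≈0ʳ (ker-u i) ⟩
      0# ∎)

  module _ {m n r} (A : Matrix Carrier m n) (rank : HasRank A r) where
    private
      b = proj₁ rank
      D : Fin n → Vector Carrier r
      D j = proj₁ (Equivalence.from (proj₂ (proj₂ rank) (columns A j))
                                    (member (columns A) j))
      A≈bD : ∀ i j → A i j ≈ ∑ (λ l → D j l * b l i)
      A≈bD i j = trans
        (proj₂ (Equivalence.from (proj₂ (proj₂ rank) (columns A j))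
                                 (member (columns A) j)) i)
        (combination-∑ (D j) b i)

    -- The rank gives a factorisation of `A` as `b` times `D` through dimension `r`. The kernel of
    -- the wide factor `D` lies in the kernel of `A`.
    rank<⇒singular : r ℕ.< n → Singular A
    rank<⇒singular r<n with wide-singular r<n (λ l j → D j l)
    ... | u , u≉0 , ker-u = u , u≉0 , λ i → begin
      ∑ (λ j → A i j * u j)
        ≈⟨ ∑-cong (λ j → trans (*-comm _ _) (*-congˡ (A≈bD i j))) ⟩
      ∑ (λ j → u j * ∑ (λ l → D j l * b l i))
        ≈⟨ ∑-assoc ⟩
      ∑ (λ l → ∑ (λ j → u j * D j l) * b l i)
        ≈⟨ ∑-zero (λ l → *≈0ˡ (trans (∑-cong λ j → *-comm _ _) (ker-u l))) ⟩
      0# ∎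

    -- In the same factorisation, a vector orthogonal to all `r` basis vectors annihilates every
    -- column. The basis vectors are the rows of a wide matrix.
    rank<⇒singularᵀ : r ℕ.< m → Singular λ j i → A i j
    rank<⇒singularᵀ r<m with wide-singular r<m b
    ... | w , w≉0 , ker-w = w , w≉0 , λ j → begin
      ∑ (λ i → A i j * w i)
        ≈⟨ ∑-cong (λ i → trans (*-comm _ _) (*-congˡ
             (trans (A≈bD i j) (∑-cong λ l → *-comm _ _)))) ⟩
      ∑ (λ i → w i * ∑ (λ l → b l i * D j l))
        ≈⟨ ∑-assoc ⟩
      ∑ (λ l → ∑ (λ i → w i * b l i) * D j l)
        ≈⟨ ∑-zero (λ l → *≈0ˡ (trans (∑-cong λ i → *-comm _ _) (ker-w l))) ⟩
      0# ∎

-- Clearing denominators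

module FractionField (em : ExcludedMiddle 0ℓ) (R : IntegralDomain) where
  open IntegralDomain R hiding (zero)
  open Fractions R
  open Sums commutativeRing using (*≈0ˡ; *≈0ʳ; -‿distribˡ-*)
  open LinearAlgebra em R using (cancelˡ)
  open SetoidReasoning setoid
  open SemiringSolver commutativeSemiring using (solve; _:+_; _:*_; _:=_)
  private
    module Raw = RawRing fractionRing

  cancel-*ˡ : ∀ {x y z} → ¬ x ≈ 0# → x * y ≈ x * z → y ≈ z
  cancel-*ˡ {x} {y} {z} x≉0 xy≈xz = begin
    y              ≈⟨ +-identityʳ y ⟨
    y + 0#         ≈⟨ +-congˡ (-‿inverseˡ z) ⟨
    y + (- z + z)  ≈⟨ +-assoc y (- z) z ⟨
    (y - z) + z    ≈⟨ +-congʳ (cancelˡ x≉0 x[y-z]≈0) ⟩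
    0# + z         ≈⟨ +-identityˡ z ⟩
    z              ∎
    where
    x[y-z]≈0 : x * (y - z) ≈ 0#
    x[y-z]≈0 = begin
      x * (y - z)      ≈⟨ distribˡ x y (- z) ⟩
      x * y + x * - z  ≈⟨ +-congʳ xy≈xz ⟩
      x * z + x * - z  ≈⟨ distribˡ x z (- z) ⟨
      x * (z - z)      ≈⟨ *≈0ʳ (-‿inverseʳ z) ⟩
      0#               ∎

  -- Cross-multiplication equates the outer fractions only up to the factor `d`, the middle
  -- denominator, which can be cancelled because it is nonzero in a domain.
  ≈ᶠ-trans : ∀ {x y z} → x Raw.≈ y → y Raw.≈ z → x Raw.≈ z
  ≈ᶠ-trans {a over b [ _ ]} {c over d [ d≉0 ]} {e over f [ _ ]} ad≈cb cf≈ed =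
    cancel-*ˡ d≉0 (begin
      d * (a * f)  ≈⟨ solve 3 (λ a d f → d :* (a :* f) := a :* d :* f) refl a d f ⟩
      a * d * f    ≈⟨ *-congʳ ad≈cb ⟩
      c * b * f    ≈⟨ solve 3 (λ b c f → c :* b :* f := c :* f :* b) refl b c f ⟩
      c * f * b    ≈⟨ *-congʳ cf≈ed ⟩
      e * d * b    ≈⟨ solve 3 (λ b d e → e :* d :* b := d :* (e :* b)) refl b d e ⟩
      d * (e * b)  ∎)

  +ᶠ-cong : ∀ {x x′ y y′} → x Raw.≈ x′ → y Raw.≈ y′ → x Raw.+ y Raw.≈ x′ Raw.+ y′
  +ᶠ-cong {a over b [ _ ]} {a′ over b′ [ _ ]} {c over d [ _ ]} {c′ over d′ [ _ ]}
          ab′≈a′b cd′≈c′d = begin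
    (a * d + c * b) * (b′ * d′)
      ≈⟨ solve 6 (λ a b c d b′ d′ →
           (a :* d :+ c :* b) :* (b′ :* d′) :=
           a :* b′ :* (d :* d′) :+ c :* d′ :* (b :* b′)) refl a b c d b′ d′ ⟩
    a * b′ * (d * d′) + c * d′ * (b * b′)
      ≈⟨ +-cong (*-congʳ ab′≈a′b) (*-congʳ cd′≈c′d) ⟩
    a′ * b * (d * d′) + c′ * d * (b * b′)
      ≈⟨ solve 6 (λ a′ b c′ d b′ d′ →
           a′ :* b :* (d :* d′) :+ c′ :* d :* (b :* b′) :=
           (a′ :* d′ :+ c′ :* b′) :* (b :* d)) refl a′ b c′ d b′ d′ ⟩
    (a′ * d′ + c′ * b′) * (b * d) ∎

  *ᶠ-cong : ∀ {x x′ y y′} → x Raw.≈ x′ → y Raw.≈ y′ → x Raw.* y Raw.≈ x′ Raw.* y′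
  *ᶠ-cong {a over b [ _ ]} {a′ over b′ [ _ ]} {c over d [ _ ]} {c′ over d′ [ _ ]}
          ab′≈a′b cd′≈c′d = begin
    a * c * (b′ * d′)    ≈⟨ interchange a c b′ d′ ⟩
    a * b′ * (c * d′)    ≈⟨ *-cong ab′≈a′b cd′≈c′d ⟩
    a′ * b * (c′ * d)    ≈⟨ interchange a′ b c′ d ⟩
    a′ * c′ * (b * d)    ∎
    where
    interchange : ∀ x y z w → x * y * (z * w) ≈ x * z * (y * w)
    interchange = solve 4 (λ x y z w → x :* y :* (z :* w) := x :* z :* (y :* w)) refl

  +ᶠ-assoc : ∀ x y z → (x Raw.+ y) Raw.+ z Raw.≈ x Raw.+ (y Raw.+ z)
  +ᶠ-assoc (a over b [ _ ]) (c over d [ _ ]) (e over f [ _ ]) =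
    solve 6 (λ a b c d e f →
      ((a :* d :+ c :* b) :* f :+ e :* (b :* d)) :* (b :* (d :* f)) :=
      (a :* (d :* f) :+ (c :* f :+ e :* d) :* b) :* (b :* d :* f)) refl a b c d e f

  +ᶠ-comm : ∀ x y → x Raw.+ y Raw.≈ y Raw.+ x
  +ᶠ-comm (a over b [ _ ]) (c over d [ _ ]) =
    solve 4 (λ a b c d →
      (a :* d :+ c :* b) :* (d :* b) := (c :* b :+ a :* d) :* (b :* d)) refl a b c d

  +ᶠ-identityˡ : ∀ x → Raw.0# Raw.+ x Raw.≈ x
  +ᶠ-identityˡ (a over b [ _ ]) = *-cong
    (trans (+-cong (zeroˡ b) (*-identityʳ a)) (+-identityˡ a)) (sym (*-identityˡ b))

  -ᶠ-inverseˡ : ∀ x → Raw.- x Raw.+ x Raw.≈ Raw.0#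
  -ᶠ-inverseˡ (a over b [ _ ]) =
    trans (*≈0ˡ (trans (sym (distribʳ b (- a) a)) (*≈0ˡ (-‿inverseˡ a))))
          (sym (zeroˡ _))

  -ᶠ-cong : ∀ {x y} → x Raw.≈ y → Raw.- x Raw.≈ Raw.- y
  -ᶠ-cong {a over b [ _ ]} {c over d [ _ ]} ad≈cb =
    trans (sym (-‿distribˡ-* a d)) (trans (-‿cong ad≈cb) (-‿distribˡ-* c b))

  *ᶠ-assoc : ∀ x y z → (x Raw.* y) Raw.* z Raw.≈ x Raw.* (y Raw.* z)
  *ᶠ-assoc (a over b [ _ ]) (c over d [ _ ]) (e over f [ _ ]) =
    *-cong (*-assoc a c e) (sym (*-assoc b d f))

  *ᶠ-comm : ∀ x y → x Raw.* y Raw.≈ y Raw.* x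
  *ᶠ-comm (a over b [ _ ]) (c over d [ _ ]) = *-cong (*-comm a c) (*-comm d b)

  *ᶠ-identityˡ : ∀ x → Raw.1# Raw.* x Raw.≈ x
  *ᶠ-identityˡ (a over b [ _ ]) = *-cong (*-identityˡ a) (sym (*-identityˡ b))

  *ᶠ-distribˡ : ∀ x y z → x Raw.* (y Raw.+ z) Raw.≈ x Raw.* y Raw.+ x Raw.* z
  *ᶠ-distribˡ (a over b [ _ ]) (c over d [ _ ]) (e over f [ _ ]) =
    solve 6 (λ a b c d e f →
      a :* (c :* f :+ e :* d) :* (b :* d :* (b :* f)) :=
      (a :* c :* (b :* f) :+ a :* e :* (b :* d)) :* (b :* (d :* f))) refl a b c d e f

  -- An equation of fractions unfolds to an equation of products in `R`, which does not determine
  -- the fractions; hence the implicit arguments written out.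
  fractionDomain : IntegralDomain
  fractionDomain = record
    { commutativeRing = record
      { Carrier = Fraction
      ; _≈_ = Raw._≈_
      ; _+_ = Raw._+_
      ; _*_ = Raw._*_
      ; -_  = Raw.-_
      ; 0#  = Raw.0#
      ; 1#  = Raw.1#
      ; isCommutativeRing = record
        { isRing = record
          { +-isAbelianGroup = record
            { isGroup = record
              { isMonoid = record
                { isSemigroup = record
                  { isMagma = record
                    { isEquivalence = record
                      { refl  = refl
                      ; sym   = sym
                      ; trans = λ {x} {y} {z} → ≈ᶠ-trans {x} {y} {z}
                      }
                    ; ∙-cong = λ {x} {x′} {y} {y′} → +ᶠ-cong {x} {x′} {y} {y′}
                    }
                  ; assoc = +ᶠ-assoc
                  }
                ; identity = +ᶠ-identityˡ , λ x →
                    ≈ᶠ-trans {x Raw.+ Raw.0#} {Raw.0# Raw.+ x} {x}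
                      (+ᶠ-comm x Raw.0#) (+ᶠ-identityˡ x)
                }
              ; inverse = -ᶠ-inverseˡ , λ x →
                  ≈ᶠ-trans {x Raw.+ Raw.- x} {Raw.- x Raw.+ x} {Raw.0#}
                    (+ᶠ-comm x (Raw.- x)) (-ᶠ-inverseˡ x)
              ; ⁻¹-cong = λ {x} {y} → -ᶠ-cong {x} {y}
              }
            ; comm = +ᶠ-comm
            }
          ; *-cong = λ {x} {x′} {y} {y′} → *ᶠ-cong {x} {x′} {y} {y′}
          ; *-assoc = *ᶠ-assoc
          ; *-identity = *ᶠ-identityˡ , λ x →
              ≈ᶠ-trans {x Raw.* Raw.1#} {Raw.1# Raw.* x} {x}
                (*ᶠ-comm x Raw.1#) (*ᶠ-identityˡ x)
          ; distrib = *ᶠ-distribˡ , λ x y z →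
              ≈ᶠ-trans {(y Raw.+ z) Raw.* x} {x Raw.* (y Raw.+ z)} {y Raw.* x Raw.+ z Raw.* x}
                (*ᶠ-comm (y Raw.+ z) x)
                (≈ᶠ-trans {x Raw.* (y Raw.+ z)} {x Raw.* y Raw.+ x Raw.* z}
                          {y Raw.* x Raw.+ z Raw.* x}
                  (*ᶠ-distribˡ x y z)
                  (+ᶠ-cong {x Raw.* y} {y Raw.* x} {x Raw.* z} {z Raw.* x}
                    (*ᶠ-comm x y) (*ᶠ-comm x z)))
          }
        ; *-comm = *ᶠ-comm
        }
      }
    ; 1≉0 = λ e → 1≉0 (trans (sym (*-identityʳ 1#)) (trans e (zeroˡ 1#)))
    ; noZeroDivisors = noZeroDivisorsᶠ
    }
    where
    ≈0 : ∀ {a} b → a ≈ 0# → a * 1# ≈ 0# * b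
    ≈0 b a≈0 = trans (*≈0ˡ a≈0) (sym (zeroˡ b))
    noZeroDivisorsᶠ : ∀ x y → x Raw.* y Raw.≈ Raw.0# →
                      (x Raw.≈ Raw.0#) Sum.⊎ (y Raw.≈ Raw.0#)
    noZeroDivisorsᶠ (a over b [ _ ]) (c over d [ _ ]) e =
      Sum.map (≈0 b) (≈0 d) (noZeroDivisors a c
        (trans (sym (*-identityʳ _)) (trans e (zeroˡ _))))

module Denominators (em : ExcludedMiddle 0ℓ) (R : IntegralDomain) where
  open IntegralDomain R hiding (zero; setoid)
  open Fractions R
  open FractionField em R
  open SemiringSolver commutativeSemiring using (solve; _:*_; _:=_)
  private
    module F = IntegralDomain fractionDomain
    module ∑R = Sums commutativeRing
    module ∑F = Sums F.commutativeRing
    module LF = LinearAlgebra em fractionDomain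
    module LR = LinearAlgebra em R
  open SetoidReasoning F.setoid

  embed-cong : ∀ {a b} → a ≈ b → embed a F.≈ embed b
  embed-cong = *-congʳ

  embed-injective : ∀ {a b} → embed a F.≈ embed b → a ≈ b
  embed-injective e = trans (sym (*-identityʳ _)) (trans e (*-identityʳ _))

  embed-+ : ∀ a b → embed a F.+ embed b F.≈ embed (a + b)
  embed-+ a b = *-cong (+-cong (*-identityʳ a) (*-identityʳ b)) (sym (*-identityʳ 1#))

  embed-* : ∀ a b → embed a F.* embed b F.≈ embed (a * b)
  embed-* a b = *-congˡ (sym (*-identityʳ 1#))

  embed-∑ : ∀ {n} (f : Vector Carrier n) → ∑F.∑ (embed ∘ f) F.≈ embed (∑R.∑ f)
  embed-∑ {zero}  f = F.trans {∑F.∑ (embed ∘ f)} {F.0#} {embed (∑R.∑ f)}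
    ∑F.∑-empty (embed-cong {0#} {∑R.∑ f} (sym ∑R.∑-empty))
  embed-∑ {suc n} f = begin
    ∑F.∑ (embed ∘ f)                           ≈⟨ ∑F.∑-suc ⟩
    embed (f zero) F.+ ∑F.∑ (embed ∘ f ∘ suc)
      ≈⟨ F.+-congˡ {embed (f zero)} {∑F.∑ (embed ∘ f ∘ suc)} {embed (∑R.∑ (f ∘ suc))}
           (embed-∑ (f ∘ suc)) ⟩
    embed (f zero) F.+ embed (∑R.∑ (f ∘ suc))  ≈⟨ embed-+ _ _ ⟩
    embed (f zero + ∑R.∑ (f ∘ suc))            ≈⟨ embed-cong (sym ∑R.∑-suc) ⟩
    embed (∑R.∑ f)                             ∎

  -- The product of all denominators serves as `d`; no least common multiple is sought.
  commonDenominator : ∀ {n} (u : Vector Fraction n) → ∃₂ λ d (p : Vector Carrier n) →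
                      ¬ d ≈ 0# × ∀ j → embed d F.* u j F.≈ embed (p j)
  commonDenominator {zero}  u = 1# , (λ ()) , 1≉0 , λ ()
  commonDenominator {suc n} u with u zero in u₀ | commonDenominator (u ∘ suc)
  ... | a over b [ b≉0 ] | d , p , d≉0 , du≈p =
    b * d , p′ , *-nonzero b≉0 d≉0 , clear
    where
    p′ : Vector Carrier (suc n)
    p′ zero    = d * a
    p′ (suc j) = b * p j
    clear : ∀ j → embed (b * d) F.* u j F.≈ embed (p′ j)
    clear zero rewrite u₀ = solve 4 (λ a b d o →
      b :* d :* a :* o := d :* a :* (o :* b)) refl a b d 1#
    clear (suc j) with u (suc j) | du≈p j
    ... | c over e [ _ ] | dc≈pe =
      trans (solve 4 (λ b c d o → b :* d :* c :* o := b :* (d :* c :* o)) refl b c d 1#)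
            (trans (*-congˡ dc≈pe) (sym (*-assoc b (p j) _)))

  -- A kernel vector stays one, and stays nonzero, when multiplied by a common denominator. Its
  -- entries then come from `R`, and the kernel equations descend because `embed` is injective.
  embed-singular : ∀ {m n} (A : Matrix Fraction m n) (P : Matrix Carrier m n) →
                   (∀ i j → A i j F.≈ embed (P i j)) → LF.Singular A → LR.Singular P
  embed-singular A P A≈P (u , (j , uj≉0) , ker-u) with commonDenominator u
  ... | d , p , d≉0 , du≈p = p , (j , pj≉0) , λ i → embed-injective (begin
    embed (∑R.∑ (λ j → P i j * p j))
      ≈⟨ embed-∑ (λ j → P i j * p j) ⟨
    ∑F.∑ (λ j → embed (P i j * p j))
      ≈⟨ ∑F.∑-cong (term i) ⟩
    ∑F.∑ (λ j → embed d F.* (A i j F.* u j))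
      ≈⟨ ∑F.*-∑ {a = embed d} ⟨
    embed d F.* ∑F.∑ (λ j → A i j F.* u j)
      ≈⟨ ∑F.*≈0ʳ {embed d} {∑F.∑ (λ j → A i j F.* u j)} (ker-u i) ⟩
    F.0# ∎)
    where
    pj≉0 : ¬ p j ≈ 0#
    pj≉0 e = uj≉0 (LF.cancelˡ {embed d} {u j} (d≉0 ∘ embed-injective)
      (F.trans {embed d F.* u j} {embed (p j)} {F.0#} (du≈p j) (embed-cong e)))
    term : ∀ i j → embed (P i j * p j) F.≈ embed d F.* (A i j F.* u j)
    term i j = begin
      embed (P i j * p j)               ≈⟨ embed-* (P i j) (p j) ⟨
      embed (P i j) F.* embed (p j)
        ≈⟨ F.*-cong {embed (P i j)} {A i j} {embed (p j)} {embed d F.* u j}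
             (F.sym {A i j} {embed (P i j)} (A≈P i j))
             (F.sym {embed d F.* u j} {embed (p j)} (du≈p j)) ⟩
      A i j F.* (embed d F.* u j)
        ≈⟨ F.*-assoc (A i j) (embed d) (u j) ⟨
      A i j F.* embed d F.* u j
        ≈⟨ F.*-congʳ {u j} {A i j F.* embed d} {embed d F.* A i j}
             (F.*-comm (A i j) (embed d)) ⟩
      embed d F.* A i j F.* u j
        ≈⟨ F.*-assoc (embed d) (A i j) (u j) ⟩
      embed d F.* (A i j F.* u j) ∎

-- Evaluation of polynomials

IsHom : (R S : CommutativeRing 0ℓ 0ℓ) →
        (CommutativeRing.Carrier R → CommutativeRing.Carrier S) → Set
IsHom R S = RingMorphisms.IsRingHomomorphism
  (CommutativeRing.rawRing R) (CommutativeRing.rawRing S)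

module Hom {R S : CommutativeRing 0ℓ 0ℓ} {φ} (φ-homo : IsHom R S φ) where
  private
    module R = CommutativeRing R
    module S = CommutativeRing S
    module ∑R = Sums R
    module ∑S = Sums S
  open RingMorphisms.IsRingHomomorphism φ-homo public

  ∑-homo : ∀ {n} (f : Vector R.Carrier n) → φ (∑R.∑ f) S.≈ ∑S.∑ (φ ∘ f)
  ∑-homo {zero}  f =
    S.trans (⟦⟧-cong ∑R.∑-empty) (S.trans 0#-homo (S.sym ∑S.∑-empty))
  ∑-homo {suc n} f = begin
    φ (∑R.∑ f)                               ≈⟨ ⟦⟧-cong ∑R.∑-suc ⟩
    φ (f zero R.+ ∑R.∑ (f ∘ suc))            ≈⟨ +-homo _ _ ⟩
    φ (f zero) S.+ φ (∑R.∑ (f ∘ suc))        ≈⟨ S.+-congˡ (∑-homo (f ∘ suc)) ⟩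
    φ (f zero) S.+ ∑S.∑ (φ ∘ f ∘ suc)        ≈⟨ ∑S.∑-suc ⟨
    ∑S.∑ (φ ∘ f)                             ∎
    where open SetoidReasoning S.setoid

module Horner (R S : CommutativeRing 0ℓ 0ℓ) {φ} (φ-homo : IsHom R S φ)
              (s : CommutativeRing.Carrier S) where
  open CommutativeRing S hiding (zero)
  open Sums S using (*≈0ʳ)
  open Algebraicity rawRing using (eval)
  open SetoidReasoning setoid
  open SemiringSolver commutativeSemiring using (solve; _:+_; _:*_; _:=_)
  private
    module R = CommutativeRing R
    module φ = Hom {R} {S} φ-homo
  open Univariate R

  -- The extension of `φ` to the polynomial ring with the variable sent to `s`. Being `eval` of the
  -- mapped list, it makes evaluation in several variables literally a one-variable evaluation after
  -- the coefficients are specialised; `nonvanishing` relies on this.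
  horner : List R.Carrier → Carrier
  horner p = eval (map φ p) s

  horner-≋[] : ∀ p → p ≋ [] → horner p ≈ 0#
  horner-≋[] []      _   = refl
  horner-≋[] (a ∷ p) e = begin
    φ a + s * horner p  ≈⟨ +-cong (trans (φ.⟦⟧-cong (∷≋[]-head e)) φ.0#-homo)
                                  (*≈0ʳ (horner-≋[] p (∷≋[]-tail e))) ⟩
    0# + 0#             ≈⟨ +-identityˡ 0# ⟩
    0#                  ∎

  horner-cong : ∀ {p q} → p ≋ q → horner p ≈ horner q
  horner-cong {[]}    {q}     e = sym (horner-≋[] q (mk≋ λ i → R.sym (at e i)))
  horner-cong {a ∷ p} {[]}    e = horner-≋[] (a ∷ p) e
  horner-cong {a ∷ p} {b ∷ q} e =
    +-cong (φ.⟦⟧-cong (at e 0)) (*-congˡ (horner-cong {p} {q} (mk≋ λ i → at e (suc i))))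

  horner-⊕ : ∀ p q → horner (p ⊕ q) ≈ horner p + horner q
  horner-⊕ []      q       = sym (+-identityˡ _)
  horner-⊕ (a ∷ p) []      = sym (+-identityʳ _)
  horner-⊕ (a ∷ p) (b ∷ q) = begin
    φ (a R.+ b) + s * horner (p ⊕ q)
      ≈⟨ +-cong (φ.+-homo a b) (*-congˡ (horner-⊕ p q)) ⟩
    φ a + φ b + s * (horner p + horner q)
      ≈⟨ solve 5 (λ a b s p q →
           a :+ b :+ s :* (p :+ q) := (a :+ s :* p) :+ (b :+ s :* q))
           refl (φ a) (φ b) s (horner p) (horner q) ⟩
    φ a + s * horner p + (φ b + s * horner q) ∎

  horner-⊙ : ∀ a p → horner (a ⊙ p) ≈ φ a * horner p
  horner-⊙ a []      = sym (zeroʳ (φ a))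
  horner-⊙ a (b ∷ p) = begin
    φ (a R.* b) + s * horner (a ⊙ p)
      ≈⟨ +-cong (φ.*-homo a b) (*-congˡ (horner-⊙ a p)) ⟩
    φ a * φ b + s * (φ a * horner p)
      ≈⟨ solve 4 (λ a b s p → a :* b :+ s :* (a :* p) := a :* (b :+ s :* p))
           refl (φ a) (φ b) s (horner p) ⟩
    φ a * (φ b + s * horner p) ∎

  horner-⊖ : ∀ p → horner (⊖ p) ≈ - horner p
  horner-⊖ p = Sums.+-inverseˡ-unique S _ _
    (trans (sym (horner-⊕ (⊖ p) p))
           (horner-≋[] (⊖ p ⊕ p) (CommutativeRing.-‿inverseˡ polynomialRing p)))

  horner-⊛ : ∀ p q → horner (p ⊛ q) ≈ horner p * horner q
  horner-⊛ []      q = sym (zeroˡ _)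
  horner-⊛ (a ∷ p) q = begin
    horner (a ⊙ q ⊕ (R.0# ∷ p ⊛ q))
      ≈⟨ horner-⊕ (a ⊙ q) _ ⟩
    horner (a ⊙ q) + (φ R.0# + s * horner (p ⊛ q))
      ≈⟨ +-cong (horner-⊙ a q)
                (trans (+-congʳ φ.0#-homo) (trans (+-identityˡ _) (*-congˡ (horner-⊛ p q)))) ⟩
    φ a * horner q + s * (horner p * horner q)
      ≈⟨ solve 4 (λ a s p q → a :* q :+ s :* (p :* q) := (a :+ s :* p) :* q)
           refl (φ a) s (horner p) (horner q) ⟩
    (φ a + s * horner p) * horner q ∎

  horner-const : ∀ a → horner (a ∷ []) ≈ φ a
  horner-const a = trans (+-congˡ (zeroʳ s)) (+-identityʳ _)

  horner-homo : IsHom polynomialRing S horner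
  horner-homo = record
    { isSemiringHomomorphism = record
      { isNearSemiringHomomorphism = record
        { +-isMonoidHomomorphism = record
          { isMagmaHomomorphism = record
            { isRelHomomorphism = record { cong = horner-cong }
            ; homo = horner-⊕
            }
          ; ε-homo = refl
          }
        ; *-homo = horner-⊛
        }
      ; 1#-homo = trans (horner-const R.1#) φ.1#-homo
      }
    ; -‿homo = horner-⊖
    }

polynomials : ℕ → CommutativeRing 0ℓ 0ℓ
polynomials k = IntegralDomain.commutativeRing ℚ[x k ]

Polynomial : ℕ → Set
Polynomial k = IntegralDomain.Carrier ℚ[x k ]

module Evaluation (S : CommutativeRing 0ℓ 0ℓ) {ρ : ℚ → CommutativeRing.Carrier S}
                  (ρ-homo : IsHom ℚ.+-*-commutativeRing S ρ) where
  open CommutativeRing S hiding (zero)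
  open SetoidReasoning setoid

  evaluate : ∀ k → Vector Carrier k → Polynomial k → Carrier
  evaluate-homo : ∀ k a → IsHom (polynomials k) S (evaluate k a)

  evaluate zero    a = ρ
  evaluate (suc k) a =
    Horner.horner (polynomials k) S (evaluate-homo k (a ∘ suc)) (a zero)

  evaluate-homo zero    a = ρ-homo
  evaluate-homo (suc k) a =
    Horner.horner-homo (polynomials k) S (evaluate-homo k (a ∘ suc)) (a zero)

  evaluate-constant : ∀ k a q → evaluate k a (constant k q) ≈ ρ q
  evaluate-constant zero    a q = refl
  evaluate-constant (suc k) a q = trans
    (Horner.horner-const (polynomials k) S (evaluate-homo k (a ∘ suc)) (a zero) (constant k q))
    (evaluate-constant k (a ∘ suc) q)

  evaluate-variable : ∀ {k} a (l : Fin k) → evaluate k a (variable-x l) ≈ a l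
  evaluate-variable {suc k} a zero = begin
    φ P.0# + a zero * H.horner (P.1# ∷ [])
      ≈⟨ +-cong φ.0#-homo (*-congˡ (trans (H.horner-const P.1#) φ.1#-homo)) ⟩
    0# + a zero * 1#  ≈⟨ +-identityˡ _ ⟩
    a zero * 1#       ≈⟨ *-identityʳ _ ⟩
    a zero            ∎
    where
    module P = CommutativeRing (polynomials k)
    φ = evaluate k (a ∘ suc)
    module φ = Hom {polynomials k} {S} (evaluate-homo k (a ∘ suc))
    module H = Horner (polynomials k) S (evaluate-homo k (a ∘ suc)) (a zero)
  evaluate-variable {suc k} a (suc l) = trans
    (Horner.horner-const (polynomials k) S (evaluate-homo k (a ∘ suc)) (a zero) (variable-x l))
    (evaluate-variable (a ∘ suc) l)

module _ {S T : CommutativeRing 0ℓ 0ℓ} {ρ σ ψ}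
         (ρ-homo : IsHom ℚ.+-*-commutativeRing S ρ)
         (σ-homo : IsHom ℚ.+-*-commutativeRing T σ)
         (ψ-homo : IsHom S T ψ)
         (ψρ≈σ : ∀ q → CommutativeRing._≈_ T (ψ (ρ q)) (σ q)) where
  private
    module ES = Evaluation S ρ-homo
    module ET = Evaluation T σ-homo
    module ψ = Hom {S} {T} ψ-homo
    module S = CommutativeRing S
  open CommutativeRing T hiding (zero)

  -- A homomorphism from the polynomial ring is determined by its values on constants and variables,
  -- and the two sides agree on both.
  evaluate-natural : ∀ k {a b} → (∀ l → ψ (a l) ≈ b l) →
                     ∀ p → ψ (ES.evaluate k a p) ≈ ET.evaluate k b p
  evaluate-natural zero    ψa≈b = ψρ≈σ
  evaluate-natural (suc k) {a} {b} ψa≈b = go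
    where
    go : ∀ p → ψ (ES.evaluate (suc k) a p) ≈ ET.evaluate (suc k) b p
    go []      = ψ.0#-homo
    go (c ∷ p) = trans (ψ.+-homo _ _)
      (+-cong (evaluate-natural k (ψa≈b ∘ suc) c)
              (trans (ψ.*-homo _ _) (*-cong (ψa≈b zero) (go p))))

-- Rational points where a polynomial does not vanish

open Algebraicity ℚ.+-*-rawRing using () renaming (eval to evalℚ)

-- For a + z q(z), taking z ≥ (|a| + δ) / δ makes |z q(z)| exceed |a| by at least δ.
evalℚ-bounded-below : ∀ p → Any (_≢ 0ℚ) p → ∃₂ λ B δ → 0ℚ ℚ.< δ ×
                      (∀ z → B ℚ.≤ z → δ ℚ.≤ ∣ evalℚ p z ∣)
evalℚ-bounded-below (a ∷ p) nonzero with any? (λ q → ¬? (q ℚ.≟ 0ℚ)) p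
... | no  p≡0 with nonzero
...   | there p≢0 = ⊥-elim (p≡0 p≢0)
...   | here a≢0 = 0ℚ , ∣ a ∣ , 0<∣a∣ , λ z _ →
  ℚ.≤-reflexive (≡.cong ∣_∣ (≡.sym (≡.trans
    (≡.cong (λ w → a ℚ.+ z ℚ.* w) (vanish p p≡0 z))
    (≡.trans (≡.cong (a ℚ.+_) (ℚ.*-zeroʳ z)) (ℚ.+-identityʳ a)))))
  where
  vanish : ∀ p → ¬ Any (_≢ 0ℚ) p → ∀ z → evalℚ p z ≡ 0ℚ
  vanish []      _   z = ≡.refl
  vanish (c ∷ p) p≡0 z with c ℚ.≟ 0ℚ
  ... | no  c≢0    = ⊥-elim (p≡0 (here c≢0))
  ... | yes ≡.refl = ≡.trans (ℚ.+-identityˡ _)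
    (≡.trans (≡.cong (z ℚ.*_) (vanish p (p≡0 ∘ there) z)) (ℚ.*-zeroʳ z))
  0<∣a∣ : 0ℚ ℚ.< ∣ a ∣
  0<∣a∣ = ℚ.≰⇒> λ ∣a∣≤0 → a≢0 (ℚ.∣p∣≡0⇒p≡0 a (ℚ.≤-antisym ∣a∣≤0 (ℚ.0≤∣p∣ a)))
evalℚ-bounded-below (a ∷ p) nonzero | yes p≢0 with evalℚ-bounded-below p p≢0
... | B , δ , 0<δ , bound = B ℚ.⊔ y , δ , 0<δ , bound′
  where
  instance
    δ-pos : ℚ.Positive δ
    δ-pos = ℚ.positive 0<δ
    δ-nonZero : ℚ.NonZero δ
    δ-nonZero = ℚ.pos⇒nonZero δ
    1/δ-pos : ℚ.Positive (ℚ.1/ δ)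
    1/δ-pos = ℚ.1/pos⇒pos δ
    δ-nonNeg : ℚ.NonNegative δ
    δ-nonNeg = ℚ.pos⇒nonNeg δ
    1/δ-nonNeg : ℚ.NonNegative (ℚ.1/ δ)
    1/δ-nonNeg = ℚ.pos⇒nonNeg (ℚ.1/ δ)
  c = ∣ a ∣ ℚ.+ δ
  y = c ℚ.* ℚ.1/ δ
  0≤c : 0ℚ ℚ.≤ c
  0≤c = ℚ.+-mono-≤ (ℚ.0≤∣p∣ a) (ℚ.<⇒≤ 0<δ)
  0≤y : 0ℚ ℚ.≤ y
  0≤y = ≡.subst (ℚ._≤ y) (ℚ.*-zeroˡ (ℚ.1/ δ)) (ℚ.*-monoʳ-≤-nonNeg (ℚ.1/ δ) 0≤c)
  yδ≡c : y ℚ.* δ ≡ c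
  yδ≡c = ≡.trans (ℚ.*-assoc c (ℚ.1/ δ) δ)
    (≡.trans (≡.cong (c ℚ.*_) (ℚ.*-inverseˡ δ)) (ℚ.*-identityʳ c))
  open ℚ.≤-Reasoning
  bound′ : ∀ z → B ℚ.⊔ y ℚ.≤ z → δ ℚ.≤ ∣ a ℚ.+ z ℚ.* evalℚ p z ∣
  bound′ z B⊔y≤z = cancel ∣ a ∣ (begin
    ∣ a ∣ ℚ.+ δ          ≡⟨ yδ≡c ⟨
    y ℚ.* δ              ≤⟨ ℚ.*-monoʳ-≤-nonNeg δ y≤z ⟩
    z ℚ.* δ              ≤⟨ ℚ.*-monoˡ-≤-nonNeg z {{z-nonNeg}} (bound z B≤z) ⟩
    z ℚ.* ∣ q ∣          ≡⟨ ≡.cong (ℚ._* ∣ q ∣) (ℚ.0≤p⇒∣p∣≡p (ℚ.≤-trans 0≤y y≤z)) ⟨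
    ∣ z ∣ ℚ.* ∣ q ∣      ≡⟨ ℚ.∣p*q∣≡∣p∣*∣q∣ z q ⟨
    ∣ z ℚ.* q ∣          ≡⟨ ≡.cong ∣_∣ (regroup a (z ℚ.* q)) ⟩
    ∣ ℚ.- a ℚ.+ (a ℚ.+ z ℚ.* q) ∣        ≤⟨ ℚ.∣p+q∣≤∣p∣+∣q∣ (ℚ.- a) _ ⟩
    ∣ ℚ.- a ∣ ℚ.+ ∣ a ℚ.+ z ℚ.* q ∣      ≡⟨ ≡.cong (ℚ._+ ∣ a ℚ.+ z ℚ.* q ∣) (ℚ.∣-p∣≡∣p∣ a) ⟩
    ∣ a ∣ ℚ.+ ∣ a ℚ.+ z ℚ.* q ∣          ∎)
    where
    q = evalℚ p z
    B≤z = ℚ.≤-trans (ℚ.p≤p⊔q B y) B⊔y≤z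
    y≤z = ℚ.≤-trans (ℚ.p≤q⊔p B y) B⊔y≤z
    z-nonNeg = ℚ.nonNegative (ℚ.≤-trans 0≤y y≤z)
    regroup : ∀ a w → w ≡ ℚ.- a ℚ.+ (a ℚ.+ w)
    regroup = solve 2 (λ a w → w := :- a :+ (a :+ w)) ≡.refl
      where open +-*-Solver
    cancel : ∀ s {t u} → s ℚ.+ t ℚ.≤ s ℚ.+ u → t ℚ.≤ u
    cancel s {t} {u} s+t≤s+u = ≡.subst₂ ℚ._≤_
      (≡.sym (regroup s t)) (≡.sym (regroup s u)) (ℚ.+-monoʳ-≤ (ℚ.- s) s+t≤s+u)

nonroot : ∀ p → Any (_≢ 0ℚ) p → ∃[ z ] evalℚ p z ≢ 0ℚ
nonroot p nonzero with evalℚ-bounded-below p nonzero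
... | B , δ , 0<δ , bound = B , λ pB≡0 →
  ℚ.<-irrefl ≡.refl (ℚ.<-≤-trans 0<δ
    (≡.subst (λ w → δ ℚ.≤ ∣ w ∣) pB≡0 (bound B ℚ.≤-refl)))

idℚ-homo : IsHom ℚ.+-*-commutativeRing ℚ.+-*-commutativeRing id
idℚ-homo = record
  { isSemiringHomomorphism = record
    { isNearSemiringHomomorphism = record
      { +-isMonoidHomomorphism = record
        { isMagmaHomomorphism = record
          { isRelHomomorphism = record { cong = id }
          ; homo = λ _ _ → ≡.refl
          }
        ; ε-homo = ≡.refl
        }
      ; *-homo = λ _ _ → ≡.refl
      }
    ; 1#-homo = ≡.refl
    }
  ; -‿homo = λ _ → ≡.refl
  }

module Evalℚ = Evaluation ℚ.+-*-commutativeRing idℚ-homo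

module _ (em : ExcludedMiddle 0ℓ) where

  nonzeroCoefficient : (R : CommutativeRing 0ℓ 0ℓ) → let open CommutativeRing R in
    ∀ p → ¬ Univariate._≋_ R p [] → Any (λ a → ¬ a ≈ 0#) p
  nonzeroCoefficient R []      p≉0 = ⊥-elim (p≉0 (CommutativeRing.refl (Univariate.polynomialRing R)))
  nonzeroCoefficient R (a ∷ p) p≉0 with em {P = CommutativeRing._≈_ R a (CommutativeRing.0# R)}
  ... | yes a≈0 = there (nonzeroCoefficient R p (p≉0 ∘ Univariate.∷≋[] R a≈0))
  ... | no  a≉0 = here a≉0

  -- Induction on the number of variables. The inner variables are specialised first, at a point
  -- that keeps some coefficient of the outermost variable nonzero. The result is a nonzero
  -- polynomial in one variable, and `nonroot` supplies the last coordinate.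
  nonvanishing : ∀ k (p : Polynomial k) → let open CommutativeRing (polynomials k) in
                 ¬ p ≈ 0# → ∃[ a ] Evalℚ.evaluate k a p ≢ 0ℚ
  specialise : ∀ k p → let open CommutativeRing (polynomials k) in
               Any (λ c → ¬ c ≈ 0#) p →
               ∃[ a ] Any (_≢ 0ℚ) (map (Evalℚ.evaluate k a) p)

  nonvanishing zero    p p≉0 = (λ ()) , p≉0
  nonvanishing (suc k) p p≉0
    with a , nonzero ← specialise k p (nonzeroCoefficient (polynomials k) p p≉0)
    with z , pz≢0 ← nonroot _ nonzero =
    (λ { zero → z ; (suc l) → a l }) , pz≢0

  specialise k (c ∷ p) (here c≉0) with nonvanishing k c c≉0
  ... | a , ca≢0 = a , here ca≢0
  specialise k (c ∷ p) (there p≉0) with specialise k p p≉0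
  ... | a , nonzero = a , there nonzero

-- The domain ℂ

open RealArithmetic
open +-*-Solver using (solve; _:+_; _:*_; :-_; _:-_; _:=_; con)

-- By definition `x ≈ᴿ y` says that the difference of the two sequences is `Null`. The ring laws of
-- the reals thus reduce to identities between rational terms.
Null : (ℕ → ℚ) → Set
Null s = ∀ ε → 0ℚ ℚ.< ε → ∃[ N ] ∀ n → N ℕ.≤ n → ∣ s n ∣ ℚ.< ε

null-≗ : ∀ {s t} → (∀ n → s n ≡ t n) → Null s → Null t
null-≗ s≗t null ε 0<ε with null ε 0<ε
... | N , h = N , λ n N≤n → ≡.subst (λ q → ∣ q ∣ ℚ.< ε) (s≗t n) (h n N≤n)

null-0 : ∀ {s} → (∀ n → s n ≡ 0ℚ) → Null s
null-0 s≗0 ε 0<ε = 0 , λ n _ → ≡.subst (λ q → ∣ q ∣ ℚ.< ε) (≡.sym (s≗0 n)) 0<ε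

null-+ : ∀ {s t} → Null s → Null t → Null (λ n → s n ℚ.+ t n)
null-+ {s} {t} ns nt ε 0<ε
  with ns (½ ℚ.* ε) (half-pos 0<ε) | nt (½ ℚ.* ε) (half-pos 0<ε)
... | M , hs | N , ht = M ℕ.+ N , λ n M+N≤n → begin-strict
  ∣ s n ℚ.+ t n ∣          ≤⟨ ℚ.∣p+q∣≤∣p∣+∣q∣ (s n) (t n) ⟩
  ∣ s n ∣ ℚ.+ ∣ t n ∣      <⟨ ℚ.+-mono-< (hs n (ℕ.m+n≤o⇒m≤o M M+N≤n))
                                         (ht n (ℕ.m+n≤o⇒n≤o M M+N≤n)) ⟩
  ½ ℚ.* ε ℚ.+ ½ ℚ.* ε      ≡⟨ halves ε ⟩
  ε                        ∎
  where open ℚ.≤-Reasoning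

null-neg : ∀ {s} → Null s → Null (λ n → ℚ.- s n)
null-neg {s} null ε 0<ε with null ε 0<ε
... | N , h = N , λ n N≤n → ≡.subst (ℚ._< ε) (≡.sym (ℚ.∣-p∣≡∣p∣ (s n))) (h n N≤n)

null-* : ∀ {s t} → Cauchy s → Null t → Null (λ n → s n ℚ.* t n)
null-* {s} {t} cs nt ε 0<ε with bounded s cs
... | B , 0<B , s≤B with shrink B 0<B ε 0<ε
... | δ , 0<δ , Bδ with nt δ 0<δ
... | N , h = N , λ n N≤n → begin-strict
  ∣ s n ℚ.* t n ∣          <⟨ *-bound (s n) (t n) 0<B (s≤B n) (h n N≤n) ⟩
  B ℚ.* δ                  ≡⟨ Bδ ⟩
  ½ ℚ.* ε                  ≤⟨ a≤a+b (½ ℚ.* ε) (½ ℚ.* ε) (ℚ.<⇒≤ (half-pos 0<ε)) ⟩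
  ½ ℚ.* ε ℚ.+ ½ ℚ.* ε      ≡⟨ halves ε ⟩
  ε                        ∎
  where open ℚ.≤-Reasoning

p*p≡∣p∣*∣p∣ : ∀ p → p ℚ.* p ≡ ∣ p ∣ ℚ.* ∣ p ∣
p*p≡∣p∣*∣p∣ p with ℚ.∣p∣≡p∨∣p∣≡-p p
... | inj₁ e = ≡.sym (≡.cong₂ ℚ._*_ e e)
... | inj₂ e = ≡.trans (solve 1 (λ p → p :* p := (:- p) :* (:- p)) ≡.refl p)
                       (≡.sym (≡.cong₂ ℚ._*_ e e))

*-mono-≤-nonNeg : ∀ {p q r s} → 0ℚ ℚ.≤ p → 0ℚ ℚ.≤ s → p ℚ.≤ q → r ℚ.≤ s →
                  p ℚ.* r ℚ.≤ q ℚ.* s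
*-mono-≤-nonNeg {p} {q} {r} {s} 0≤p 0≤s p≤q r≤s = ℚ.≤-trans
  (ℚ.*-monoˡ-≤-nonNeg p {{ℚ.nonNegative 0≤p}} r≤s)
  (ℚ.*-monoʳ-≤-nonNeg s {{ℚ.nonNegative 0≤s}} p≤q)

-- The hypothesis is used with the bound ε²: an index with |s n| ≥ ε would make the sum of squares
-- at least ε².
null-sumOfSquares : ∀ {s t : ℕ → ℚ} → Null (λ n → s n ℚ.* s n ℚ.+ t n ℚ.* t n) → Null s
null-sumOfSquares {s} {t} null ε 0<ε with null (ε ℚ.* ε) 0<ε*ε
  where
  0<ε*ε : 0ℚ ℚ.< ε ℚ.* ε
  0<ε*ε = ≡.subst (ℚ._< ε ℚ.* ε) (ℚ.*-zeroʳ ε)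
                  (ℚ.*-monoʳ-<-pos ε {{ℚ.positive 0<ε}} 0<ε)
... | N , h = N , small
  where
  open ℚ.≤-Reasoning
  small : ∀ n → N ℕ.≤ n → ∣ s n ∣ ℚ.< ε
  small n N≤n with ∣ s n ∣ ℚ.<? ε
  ... | yes s<ε = s<ε
  ... | no  s≮ε = ⊥-elim (ℚ.<-irrefl ≡.refl (begin-strict
    ε ℚ.* ε
      ≤⟨ *-mono-≤-nonNeg (ℚ.<⇒≤ 0<ε) (ℚ.0≤∣p∣ (s n)) (ℚ.≮⇒≥ s≮ε) (ℚ.≮⇒≥ s≮ε) ⟩
    ∣ s n ∣ ℚ.* ∣ s n ∣
      ≡⟨ p*p≡∣p∣*∣p∣ (s n) ⟨
    s n ℚ.* s n
      ≤⟨ a≤a+b _ _ (≡.subst (0ℚ ℚ.≤_) (≡.sym (p*p≡∣p∣*∣p∣ (t n)))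
           (*-mono-≤-nonNeg ℚ.≤-refl (ℚ.0≤∣p∣ (t n)) (ℚ.0≤∣p∣ (t n)) (ℚ.0≤∣p∣ (t n)))) ⟩
    s n ℚ.* s n ℚ.+ t n ℚ.* t n
      ≤⟨ p≤∣p∣ _ ⟩
    ∣ s n ℚ.* s n ℚ.+ t n ℚ.* t n ∣
      <⟨ h n N≤n ⟩
    ε ℚ.* ε ∎))
    where
    p≤∣p∣ : ∀ p → p ℚ.≤ ∣ p ∣
    p≤∣p∣ p with ℚ.≤-total 0ℚ p
    ... | inj₁ 0≤p = ℚ.≤-reflexive (≡.sym (ℚ.0≤p⇒∣p∣≡p 0≤p))
    ... | inj₂ p≤0 = ℚ.≤-trans p≤0 (ℚ.0≤∣p∣ p)

AwayFrom0 : (ℕ → ℚ) → Set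
AwayFrom0 s = ∃₂ λ δ N → 0ℚ ℚ.< δ × (∀ n → N ℕ.≤ n → δ ℚ.≤ ∣ s n ∣)

-- Where |s n| ≥ δ and |s n t n| < δε, necessarily |t n| < ε.
null-cancel : ∀ {s t : ℕ → ℚ} → AwayFrom0 s → Null (λ n → s n ℚ.* t n) → Null t
null-cancel {s} {t} (δ , M , 0<δ , δ≤s) null ε 0<ε with null (δ ℚ.* ε) 0<δε
  where
  0<δε : 0ℚ ℚ.< δ ℚ.* ε
  0<δε = ≡.subst (ℚ._< δ ℚ.* ε) (ℚ.*-zeroʳ δ)
                 (ℚ.*-monoʳ-<-pos δ {{ℚ.positive 0<δ}} 0<ε)
... | N , h = M ℕ.+ N , small
  where
  small : ∀ n → M ℕ.+ N ℕ.≤ n → ∣ t n ∣ ℚ.< ε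
  small n M+N≤n with ∣ t n ∣ ℚ.<? ε
  ... | yes t<ε = t<ε
  ... | no  t≮ε = ⊥-elim (ℚ.<-irrefl ≡.refl (ℚ.≤-<-trans
    (*-mono-≤-nonNeg (ℚ.<⇒≤ 0<δ) (ℚ.0≤∣p∣ (t n))
      (δ≤s n (ℕ.m+n≤o⇒m≤o M M+N≤n)) (ℚ.≮⇒≥ t≮ε))
    (≡.subst (ℚ._< δ ℚ.* ε) (ℚ.∣p*q∣≡∣p∣*∣q∣ (s n) (t n))
      (h n (ℕ.m+n≤o⇒n≤o M M+N≤n)))))

module _ (em : ExcludedMiddle 0ℓ) where

  -- Past the index from which terms differ by less than ε/2, a single term of absolute value at
  -- least ε forces all the others to be at least ε/2, so `s` would be away from 0.
  null⊎away : ∀ {s} → Cauchy s → Null s ⊎ AwayFrom0 s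
  null⊎away {s} cs with em {P = AwayFrom0 s}
  ... | yes away  = inj₂ away
  ... | no  ¬away = inj₁ null
    where
    null : Null s
    null ε 0<ε with cs (½ ℚ.* ε) (half-pos 0<ε)
    ... | N , close = N , small
      where
      open ℚ.≤-Reasoning
      small : ∀ n → N ℕ.≤ n → ∣ s n ∣ ℚ.< ε
      small n N≤n with ∣ s n ∣ ℚ.<? ε
      ... | yes s<ε = s<ε
      ... | no  s≮ε = ⊥-elim (¬away (½ ℚ.* ε , N , half-pos 0<ε , λ m N≤m →
        ℚ.≮⇒≥ λ s<½ε → s≮ε (begin-strict
          ∣ s n ∣
            ≡⟨ ≡.cong ∣_∣ (solve 2 (λ p q → p := (p :- q) :+ q) ≡.refl (s n) (s m)) ⟩
          ∣ (s n ℚ.- s m) ℚ.+ s m ∣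
            ≤⟨ ℚ.∣p+q∣≤∣p∣+∣q∣ (s n ℚ.- s m) (s m) ⟩
          ∣ s n ℚ.- s m ∣ ℚ.+ ∣ s m ∣
            <⟨ ℚ.+-mono-< (close n m N≤n N≤m) s<½ε ⟩
          ½ ℚ.* ε ℚ.+ ½ ℚ.* ε
            ≡⟨ halves ε ⟩
          ε ∎)))

  null-noZeroDivisors : ∀ {s t} → Cauchy s → Null (λ n → s n ℚ.* t n) → Null s ⊎ Null t
  null-noZeroDivisors cs null = Sum.map₂ (λ away → null-cancel away null) (null⊎away cs)

open ℝ
open ℂ
private
  module ℂ-Raw = RawRing ℂ-rawRing

≗⇒≈ᴿ : ∀ x y → (∀ n → seq x n ≡ seq y n) → x ≈ᴿ y
≗⇒≈ᴿ x y x≗y = null-0 λ n →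
  ≡.trans (≡.cong (ℚ._- seq y n) (x≗y n)) (ℚ.+-inverseʳ (seq y n))

≈ᴿ-sym : ∀ x y → x ≈ᴿ y → y ≈ᴿ x
≈ᴿ-sym x y x≈y = null-≗
  (λ n → solve 2 (λ p q → :- (p :- q) := q :- p) ≡.refl (seq x n) (seq y n))
  (null-neg x≈y)

≈ᴿ-trans : ∀ x y z → x ≈ᴿ y → y ≈ᴿ z → x ≈ᴿ z
≈ᴿ-trans x y z x≈y y≈z = null-≗
  (λ n → solve 3 (λ p q r → (p :- q) :+ (q :- r) := p :- r) ≡.refl
    (seq x n) (seq y n) (seq z n))
  (null-+ x≈y y≈z)

+ᴿ-cong : ∀ x x′ y y′ → x ≈ᴿ x′ → y ≈ᴿ y′ → x +ᴿ y ≈ᴿ x′ +ᴿ y′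
+ᴿ-cong x x′ y y′ x≈x′ y≈y′ = null-≗
  (λ n → solve 4 (λ p p′ q q′ → (p :- p′) :+ (q :- q′) := (p :+ q) :- (p′ :+ q′)) ≡.refl
    (seq x n) (seq x′ n) (seq y n) (seq y′ n))
  (null-+ x≈x′ y≈y′)

-ᴿ-cong : ∀ x x′ → x ≈ᴿ x′ → -ᴿ x ≈ᴿ -ᴿ x′
-ᴿ-cong x x′ x≈x′ = null-≗
  (λ n → solve 2 (λ p p′ → :- (p :- p′) := (:- p) :- (:- p′)) ≡.refl (seq x n) (seq x′ n))
  (null-neg x≈x′)

*ᴿ-cong : ∀ x x′ y y′ → x ≈ᴿ x′ → y ≈ᴿ y′ → x *ᴿ y ≈ᴿ x′ *ᴿ y′
*ᴿ-cong x x′ y y′ x≈x′ y≈y′ = null-≗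
  (λ n → solve 4 (λ p p′ q q′ →
    p :* (q :- q′) :+ q′ :* (p :- p′) := p :* q :- p′ :* q′) ≡.refl
    (seq x n) (seq x′ n) (seq y n) (seq y′ n))
  (null-+ {λ n → seq x n ℚ.* seq (y -ᴿ y′) n} {λ n → seq y′ n ℚ.* seq (x -ᴿ x′) n}
    (null-* {seq x} {seq (y -ᴿ y′)} (cauchy x) y≈y′)
    (null-* {seq y′} {seq (x -ᴿ x′)} (cauchy y′) x≈x′))

≗⇒≈ᶜ : ∀ z w → (∀ n → seq (re z) n ≡ seq (re w) n) → (∀ n → seq (im z) n ≡ seq (im w) n) →
       z ℂ-Raw.≈ w
≗⇒≈ᶜ z w re≗ im≗ = ≗⇒≈ᴿ (re z) (re w) re≗ , ≗⇒≈ᴿ (im z) (im w) im≗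

≈ᶜ-trans : ∀ z w v → z ℂ-Raw.≈ w → w ℂ-Raw.≈ v → z ℂ-Raw.≈ v
≈ᶜ-trans z w v (re₁ , im₁) (re₂ , im₂) =
  ≈ᴿ-trans (re z) (re w) (re v) re₁ re₂ , ≈ᴿ-trans (im z) (im w) (im v) im₁ im₂

*ᶜ-cong : ∀ {z z′ w w′} → z ℂ-Raw.≈ z′ → w ℂ-Raw.≈ w′ → z ℂ-Raw.* w ℂ-Raw.≈ z′ ℂ-Raw.* w′
*ᶜ-cong {a +i b} {a′ +i b′} {c +i d} {c′ +i d′} (a≈a′ , b≈b′) (c≈c′ , d≈d′) =
  +ᴿ-cong (a *ᴿ c) (a′ *ᴿ c′) (-ᴿ (b *ᴿ d)) (-ᴿ (b′ *ᴿ d′))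
    (*ᴿ-cong a a′ c c′ a≈a′ c≈c′)
    (-ᴿ-cong (b *ᴿ d) (b′ *ᴿ d′) (*ᴿ-cong b b′ d d′ b≈b′ d≈d′)) ,
  +ᴿ-cong (a *ᴿ d) (a′ *ᴿ d′) (b *ᴿ c) (b′ *ᴿ c′)
    (*ᴿ-cong a a′ d d′ a≈a′ d≈d′) (*ᴿ-cong b b′ c c′ b≈b′ c≈c′)

*ᶜ-assoc : ∀ z w v → (z ℂ-Raw.* w) ℂ-Raw.* v ℂ-Raw.≈ z ℂ-Raw.* (w ℂ-Raw.* v)
*ᶜ-assoc z@(a +i b) w@(c +i d) v@(e +i f) =
  ≗⇒≈ᶜ ((z ℂ-Raw.* w) ℂ-Raw.* v) (z ℂ-Raw.* (w ℂ-Raw.* v))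
    (λ n → solve 6 (λ a b c d e f →
      (a :* c :- b :* d) :* e :- (a :* d :+ b :* c) :* f :=
      a :* (c :* e :- d :* f) :- b :* (c :* f :+ d :* e)) ≡.refl
      (seq a n) (seq b n) (seq c n) (seq d n) (seq e n) (seq f n))
    (λ n → solve 6 (λ a b c d e f →
      (a :* c :- b :* d) :* f :+ (a :* d :+ b :* c) :* e :=
      a :* (c :* f :+ d :* e) :+ b :* (c :* e :- d :* f)) ≡.refl
      (seq a n) (seq b n) (seq c n) (seq d n) (seq e n) (seq f n))

*ᶜ-comm : ∀ z w → z ℂ-Raw.* w ℂ-Raw.≈ w ℂ-Raw.* z
*ᶜ-comm z@(a +i b) w@(c +i d) = ≗⇒≈ᶜ (z ℂ-Raw.* w) (w ℂ-Raw.* z)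
  (λ n → solve 4 (λ a b c d → a :* c :- b :* d := c :* a :- d :* b) ≡.refl
    (seq a n) (seq b n) (seq c n) (seq d n))
  (λ n → solve 4 (λ a b c d → a :* d :+ b :* c := c :* b :+ d :* a) ≡.refl
    (seq a n) (seq b n) (seq c n) (seq d n))

*ᶜ-identityˡ : ∀ z → ℂ-Raw.1# ℂ-Raw.* z ℂ-Raw.≈ z
*ᶜ-identityˡ z@(a +i b) = ≗⇒≈ᶜ (ℂ-Raw.1# ℂ-Raw.* z) z
  (λ n → solve 2 (λ a b → con 1ℚ :* a :- con 0ℚ :* b := a) ≡.refl (seq a n) (seq b n))
  (λ n → solve 2 (λ a b → con 1ℚ :* b :+ con 0ℚ :* a := b) ≡.refl (seq a n) (seq b n))

*ᶜ-distribˡ : ∀ z w v → z ℂ-Raw.* (w ℂ-Raw.+ v) ℂ-Raw.≈ z ℂ-Raw.* w ℂ-Raw.+ z ℂ-Raw.* v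
*ᶜ-distribˡ z@(a +i b) w@(c +i d) v@(e +i f) =
  ≗⇒≈ᶜ (z ℂ-Raw.* (w ℂ-Raw.+ v)) (z ℂ-Raw.* w ℂ-Raw.+ z ℂ-Raw.* v)
    (λ n → solve 6 (λ a b c d e f →
      a :* (c :+ e) :- b :* (d :+ f) :=
      (a :* c :- b :* d) :+ (a :* e :- b :* f)) ≡.refl
      (seq a n) (seq b n) (seq c n) (seq d n) (seq e n) (seq f n))
    (λ n → solve 6 (λ a b c d e f →
      a :* (d :+ f) :+ b :* (c :+ e) :=
      (a :* d :+ b :* c) :+ (a :* f :+ b :* e)) ≡.refl
      (seq a n) (seq b n) (seq c n) (seq d n) (seq e n) (seq f n))

ℂ-commutativeRing : CommutativeRing 0ℓ 0ℓ
ℂ-commutativeRing = record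
  { Carrier = ℂ
  ; _≈_ = ℂ-Raw._≈_
  ; _+_ = ℂ-Raw._+_
  ; _*_ = ℂ-Raw._*_
  ; -_  = ℂ-Raw.-_
  ; 0#  = ℂ-Raw.0#
  ; 1#  = ℂ-Raw.1#
  ; isCommutativeRing = record
    { isRing = record
      { +-isAbelianGroup = record
        { isGroup = record
          { isMonoid = record
            { isSemigroup = record
              { isMagma = record
                { isEquivalence = record
                  { refl  = λ {z} → ≗⇒≈ᶜ z z (λ _ → ≡.refl) (λ _ → ≡.refl)
                  ; sym   = λ {z} {w} (re≈ , im≈) →
                      ≈ᴿ-sym (re z) (re w) re≈ , ≈ᴿ-sym (im z) (im w) im≈
                  ; trans = λ {z} {w} {v} → ≈ᶜ-trans z w v
                  }
                ; ∙-cong = λ {z} {z′} {w} {w′} (re₁ , im₁) (re₂ , im₂) →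
                    +ᴿ-cong (re z) (re z′) (re w) (re w′) re₁ re₂ ,
                    +ᴿ-cong (im z) (im z′) (im w) (im w′) im₁ im₂
                }
              ; assoc = λ z w v →
                  ≗⇒≈ᶜ ((z ℂ-Raw.+ w) ℂ-Raw.+ v) (z ℂ-Raw.+ (w ℂ-Raw.+ v))
                    (λ n → ℚ.+-assoc (seq (re z) n) (seq (re w) n) (seq (re v) n))
                    (λ n → ℚ.+-assoc (seq (im z) n) (seq (im w) n) (seq (im v) n))
              }
            ; identity =
                (λ z → ≗⇒≈ᶜ (ℂ-Raw.0# ℂ-Raw.+ z) z (λ n → ℚ.+-identityˡ _) (λ n → ℚ.+-identityˡ _)) ,
                (λ z → ≗⇒≈ᶜ (z ℂ-Raw.+ ℂ-Raw.0#) z (λ n → ℚ.+-identityʳ _) (λ n → ℚ.+-identityʳ _))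
            }
          ; inverse =
              (λ z → ≗⇒≈ᶜ (ℂ-Raw.- z ℂ-Raw.+ z) ℂ-Raw.0#
                (λ n → ℚ.+-inverseˡ (seq (re z) n)) (λ n → ℚ.+-inverseˡ (seq (im z) n))) ,
              (λ z → ≗⇒≈ᶜ (z ℂ-Raw.+ ℂ-Raw.- z) ℂ-Raw.0#
                (λ n → ℚ.+-inverseʳ (seq (re z) n)) (λ n → ℚ.+-inverseʳ (seq (im z) n)))
          ; ⁻¹-cong = λ {z} {w} (re≈ , im≈) →
              -ᴿ-cong (re z) (re w) re≈ , -ᴿ-cong (im z) (im w) im≈
          }
        ; comm = λ z w → ≗⇒≈ᶜ (z ℂ-Raw.+ w) (w ℂ-Raw.+ z)
            (λ n → ℚ.+-comm (seq (re z) n) (seq (re w) n))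
            (λ n → ℚ.+-comm (seq (im z) n) (seq (im w) n))
        }
      ; *-cong = λ {z} {z′} {w} {w′} → *ᶜ-cong {z} {z′} {w} {w′}
      ; *-assoc = *ᶜ-assoc
      ; *-identity = *ᶜ-identityˡ , λ z →
          ≈ᶜ-trans (z ℂ-Raw.* ℂ-Raw.1#) (ℂ-Raw.1# ℂ-Raw.* z) z
            (*ᶜ-comm z ℂ-Raw.1#) (*ᶜ-identityˡ z)
      ; distrib = *ᶜ-distribˡ , λ z w v →
          ≈ᶜ-trans ((w ℂ-Raw.+ v) ℂ-Raw.* z) (z ℂ-Raw.* (w ℂ-Raw.+ v)) (w ℂ-Raw.* z ℂ-Raw.+ v ℂ-Raw.* z)
            (*ᶜ-comm (w ℂ-Raw.+ v) z)
            (≈ᶜ-trans (z ℂ-Raw.* (w ℂ-Raw.+ v)) (z ℂ-Raw.* w ℂ-Raw.+ z ℂ-Raw.* v)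
                      (w ℂ-Raw.* z ℂ-Raw.+ v ℂ-Raw.* z)
              (*ᶜ-distribˡ z w v)
              (+ᴿ-cong (re (z ℂ-Raw.* w)) (re (w ℂ-Raw.* z)) (re (z ℂ-Raw.* v)) (re (v ℂ-Raw.* z))
                 (proj₁ (*ᶜ-comm z w)) (proj₁ (*ᶜ-comm z v)) ,
               +ᴿ-cong (im (z ℂ-Raw.* w)) (im (w ℂ-Raw.* z)) (im (z ℂ-Raw.* v)) (im (v ℂ-Raw.* z))
                 (proj₂ (*ᶜ-comm z w)) (proj₂ (*ᶜ-comm z v))))
      }
    ; *-comm = *ᶜ-comm
    }
  }

-- |z|² |w|² = |zw|² reduces the absence of zero divisors in ℂ to that in ℝ.
ℂ-noZeroDivisors : ExcludedMiddle 0ℓ → ∀ z w → z ℂ-Raw.* w ℂ-Raw.≈ ℂ-Raw.0# →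
                   z ℂ-Raw.≈ ℂ-Raw.0# ⊎ w ℂ-Raw.≈ ℂ-Raw.0#
ℂ-noZeroDivisors em z@(a +i b) w@(c +i d) (re≈0 , im≈0) =
  Sum.map (zero-of z) (zero-of w)
    (null-noZeroDivisors em {∣ z ∣²} {∣ w ∣²} (cauchy (a *ᴿ a +ᴿ b *ᴿ b))
      (null-≗ {λ n → seq P n ℚ.* seq P n ℚ.+ seq Q n ℚ.* seq Q n} (λ n → solve 4 (λ a b c d →
         let p = (a :* c :- b :* d) :- con 0ℚ
             q = (a :* d :+ b :* c) :- con 0ℚ
         in p :* p :+ q :* q := (a :* a :+ b :* b) :* (c :* c :+ d :* d)) ≡.refl
         (seq a n) (seq b n) (seq c n) (seq d n))
       (null-+ {λ n → seq P n ℚ.* seq P n} {λ n → seq Q n ℚ.* seq Q n}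
               (null-* {seq P} {seq P} (cauchy P) re≈0)
               (null-* {seq Q} {seq Q} (cauchy Q) im≈0))))
  where
  -- The subtracted 0 is the one in the definition of `≈ᴿ`: with it, `re≈0` and `im≈0` say literally
  -- that the sequences of `P` and `Q` are null.
  P Q : ℝ
  P = re (z ℂ-Raw.* w) -ᴿ fromℚ 0ℚ
  Q = im (z ℂ-Raw.* w) -ᴿ fromℚ 0ℚ
  ∣_∣² : ℂ → ℕ → ℚ
  ∣ z ∣² n = seq (re z) n ℚ.* seq (re z) n ℚ.+ seq (im z) n ℚ.* seq (im z) n
  p≡p-0 : ∀ p → p ≡ p ℚ.- 0ℚ
  p≡p-0 p = ≡.sym (ℚ.+-identityʳ p)
  zero-of : ∀ z → Null ∣ z ∣² → z ℂ-Raw.≈ ℂ-Raw.0#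
  zero-of z null =
    null-≗ (λ n → p≡p-0 (seq (re z) n))
      (null-sumOfSquares {seq (re z)} {seq (im z)} null) ,
    null-≗ (λ n → p≡p-0 (seq (im z) n))
      (null-sumOfSquares {seq (im z)} {seq (re z)}
        (null-≗ {∣ z ∣²} (λ n → ℚ.+-comm (seq (re z) n ℚ.* seq (re z) n)
                                       (seq (im z) n ℚ.* seq (im z) n)) null))

ℂ-domain : ExcludedMiddle 0ℓ → IntegralDomain
ℂ-domain em = record
  { commutativeRing = ℂ-commutativeRing
  ; 1≉0             = 1≉0
  ; noZeroDivisors  = ℂ-noZeroDivisors em
  }
  where
  1≉0 : ¬ ℂ-Raw.1# ℂ-Raw.≈ ℂ-Raw.0#
  1≉0 (re≈0 , _) with re≈0 1ℚ 0<1
  ... | N , small = ℚ.<-irrefl ≡.refl (small N ℕ.≤-refl)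

ℚ→ℂ-homo : IsHom ℚ.+-*-commutativeRing ℂ-commutativeRing ℚ→ℂ
ℚ→ℂ-homo = record
  { isSemiringHomomorphism = record
    { isNearSemiringHomomorphism = record
      { +-isMonoidHomomorphism = record
        { isMagmaHomomorphism = record
          { isRelHomomorphism = record { cong = λ { {p} ≡.refl → refl (ℚ→ℂ p) } }
          ; homo = λ p q → ≗⇒≈ᶜ (ℚ→ℂ (p ℚ.+ q)) (ℚ→ℂ p ℂ-Raw.+ ℚ→ℂ q)
              (λ _ → ≡.refl) (λ _ → ≡.refl)
          }
        ; ε-homo = refl ℂ-Raw.0#
        }
      ; *-homo = λ p q → ≗⇒≈ᶜ (ℚ→ℂ (p ℚ.* q)) (ℚ→ℂ p ℂ-Raw.* ℚ→ℂ q)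
          (λ _ → solve 2 (λ p q → p :* q := p :* q :- con 0ℚ :* con 0ℚ) ≡.refl p q)
          (λ _ → solve 2 (λ p q → con 0ℚ := p :* con 0ℚ :+ con 0ℚ :* q) ≡.refl p q)
      }
    ; 1#-homo = refl ℂ-Raw.1#
    }
  ; -‿homo = λ p → ≗⇒≈ᶜ (ℚ→ℂ (ℚ.- p)) (ℂ-Raw.- ℚ→ℂ p) (λ _ → ≡.refl) (λ _ → ≡.refl)
  }
  where
  refl : ∀ z → z ℂ-Raw.≈ z
  refl z = ≗⇒≈ᶜ z z (λ _ → ≡.refl) (λ _ → ≡.refl)

-- Kernels of the generic matrix along a line

module Coefficients (K : CommutativeRing 0ℓ 0ℓ) where
  open CommutativeRing K hiding (zero)
  open Univariate K
  open Sums K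
  private module S = CommutativeRing polynomialRing

  coeff₀-⊛ : ∀ p q → coeff (p ⊛ q) 0 ≈ coeff p 0 * coeff q 0
  coeff₀-⊛ []      q = sym (zeroˡ _)
  coeff₀-⊛ (a ∷ p) q = trans (coeff-⊕ (a ⊙ q) _ 0)
    (trans (+-congʳ (coeff-⊙ a q 0)) (+-identityʳ _))

  -- The Leibniz rule at t = 0, the one property of differentiation that the argument uses besides
  -- additivity.
  coeff₁-⊛ : ∀ p q → coeff (p ⊛ q) 1 ≈ coeff p 0 * coeff q 1 + coeff p 1 * coeff q 0
  coeff₁-⊛ []      q = sym (trans (+-cong (zeroˡ _) (zeroˡ _)) (+-identityʳ 0#))
  coeff₁-⊛ (a ∷ p) q = trans (coeff-⊕ (a ⊙ q) _ 1)
    (+-cong (coeff-⊙ a q 1) (coeff₀-⊛ p q))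

  coeff-∑ : ∀ {n} (f : Vector (List Carrier) n) i →
            coeff (Sums.∑ polynomialRing f) i ≈ ∑ (λ j → coeff (f j) i)
  coeff-∑ {zero}  f i = trans (at (Sums.∑-empty polynomialRing) i) (sym ∑-empty)
  coeff-∑ {suc n} f i = begin
    coeff (Sums.∑ polynomialRing f) i
      ≈⟨ at (Sums.∑-suc polynomialRing) i ⟩
    coeff (f zero ⊕ Sums.∑ polynomialRing (f ∘ suc)) i
      ≈⟨ coeff-⊕ (f zero) _ i ⟩
    coeff (f zero) i + coeff (Sums.∑ polynomialRing (f ∘ suc)) i
      ≈⟨ +-congˡ (coeff-∑ (f ∘ suc) i) ⟩
    coeff (f zero) i + ∑ (λ j → coeff (f (suc j)) i)
      ≈⟨ ∑-suc ⟨
    ∑ (λ j → coeff (f j) i) ∎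
    where open SetoidReasoning setoid

  coeff₀-homo : IsHom polynomialRing K (λ p → coeff p 0)
  coeff₀-homo = record
    { isSemiringHomomorphism = record
      { isNearSemiringHomomorphism = record
        { +-isMonoidHomomorphism = record
          { isMagmaHomomorphism = record
            { isRelHomomorphism = record { cong = λ e → at e 0 }
            ; homo = λ p q → coeff-⊕ p q 0
            }
          ; ε-homo = refl
          }
        ; *-homo = coeff₀-⊛
        }
      ; 1#-homo = refl
      }
    ; -‿homo = λ p → coeff-⊖ p 0
    }

  constant-homo : ∀ {ι} → IsHom ℚ.+-*-commutativeRing K ι →
                  IsHom ℚ.+-*-commutativeRing polynomialRing (λ q → ι q ∷ [])
  constant-homo {ι} ι-homo = record
    { isSemiringHomomorphism = record
      { isNearSemiringHomomorphism = record
        { +-isMonoidHomomorphism = record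
          { isMagmaHomomorphism = record
            { isRelHomomorphism = record { cong = λ { ≡.refl → S.refl } }
            ; homo = λ p q → ∷-cong (ι.+-homo p q) S.refl
            }
          ; ε-homo = ∷≋[] ι.0#-homo S.refl
          }
        ; *-homo = λ p q → ∷-cong (trans (ι.*-homo p q) (sym (+-identityʳ _))) S.refl
        }
      ; 1#-homo = ∷-cong ι.1#-homo S.refl
      }
    ; -‿homo = λ p → ∷-cong (ι.-‿homo p) S.refl
    }
    where module ι = Hom {ℚ.+-*-commutativeRing} {K} ι-homo

-- Rational bases and the implication over a domain

module Implication (em : ExcludedMiddle 0ℓ) (K : IntegralDomain)
                   {ι : ℚ → IntegralDomain.Carrier K}
                   (ι-homo : IsHom ℚ.+-*-commutativeRing (IntegralDomain.commutativeRing K) ι)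
                   (L : Pred (IntegralDomain.Carrier K) 0ℓ) where
  open IntegralDomain K hiding (zero)
  open Conjectures rawRing ι L
  open Linear rawRing
  open Sums commutativeRing
  open LinearAlgebra em K using (det≈0⇒singular; singular⇒rank<)
  open SetoidReasoning setoid
  private module ι = Hom {ℚ.+-*-commutativeRing} {commutativeRing} ι-homo

  combinationℚ : ∀ {k} → Vector ℚ k → Vector Carrier k → Carrier
  combinationℚ c x = ∑ λ l → ι (c l) * x l

  Independent : ∀ {k} → Vector Carrier k → Set
  Independent x = ∀ c → combinationℚ c x ≈ 0# → ∀ l → c l ≡ 0ℚ

  -- A relation in which `y` has a nonzero coefficient could be solved for `y` by dividing by that
  -- rational, putting `y` in the span.
  independent-∷ : ∀ {k y} {x : Vector Carrier k} → Independent x →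
                  ¬ (∃[ c ] y ≈ combinationℚ c x) → Independent (y Vector.∷ x)
  independent-∷ {k} {y} {x} indep y∉span c cx≈0 with c zero ℚ.≟ 0ℚ
  ... | yes c₀≡0 = λ { zero → c₀≡0 ; (suc l) → indep (c ∘ suc) (begin
    combinationℚ (c ∘ suc) x                   ≈⟨ +-identityˡ _ ⟨
    0# + combinationℚ (c ∘ suc) x
      ≈⟨ +-congʳ (*≈0ˡ (trans (reflexive (≡.cong ι c₀≡0)) ι.0#-homo)) ⟨
    ι (c zero) * y + combinationℚ (c ∘ suc) x  ≈⟨ ∑-suc ⟨
    combinationℚ c (y Vector.∷ x)              ≈⟨ cx≈0 ⟩
    0#                                         ∎) l }
  ... | no c₀≢0 = ⊥-elim (y∉span ((λ l → ℚ.- d ℚ.* c (suc l)) , (begin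
    y                                    ≈⟨ +-inverseˡ-unique _ _ y+dz≈0 ⟩
    - (ι d * z)                          ≈⟨ -‿distribˡ-* _ _ ⟩
    - ι d * z                            ≈⟨ *-congʳ (ι.-‿homo d) ⟨
    ι (ℚ.- d) * z                        ≈⟨ *-∑ ⟩
    ∑ (λ l → ι (ℚ.- d) * (ι (c (suc l)) * x l))
      ≈⟨ ∑-cong (λ l → trans (sym (*-assoc _ _ _)) (*-congʳ (sym (ι.*-homo _ _)))) ⟩
    combinationℚ (λ l → ℚ.- d ℚ.* c (suc l)) x ∎)))
    where
    instance
      c₀-nonZero : ℚ.NonZero (c zero)
      c₀-nonZero = ℚ.≢-nonZero c₀≢0
    d = ℚ.1/ c zero
    z = combinationℚ (c ∘ suc) x
    y+dz≈0 : y + ι d * z ≈ 0#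
    y+dz≈0 = begin
      y + ι d * z                      ≈⟨ +-congʳ (*-identityˡ y) ⟨
      1# * y + ι d * z
        ≈⟨ +-congʳ (*-congʳ (trans (reflexive (≡.cong ι (ℚ.*-inverseˡ (c zero)))) ι.1#-homo)) ⟨
      ι (d ℚ.* c zero) * y + ι d * z
        ≈⟨ +-congʳ (trans (*-congʳ (ι.*-homo d (c zero))) (*-assoc _ _ _)) ⟩
      ι d * (ι (c zero) * y) + ι d * z ≈⟨ distribˡ _ _ _ ⟨
      ι d * (ι (c zero) * y + z)       ≈⟨ *-congˡ ∑-suc ⟨
      ι d * combinationℚ c (y Vector.∷ x)  ≈⟨ *≈0ʳ cx≈0 ⟩
      0#                               ∎

  -- An entry is added exactly when it lies outside the rational span of those already kept. All
  -- basis elements are thus entries of `y`, and membership in `L` is inherited.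
  basis : ∀ {n} (y : Vector Carrier n) → (∀ i → L (y i)) →
          ∃[ k ] ∃₂ λ (x : Vector Carrier k) (c : Fin n → Vector ℚ k) →
          (∀ l → L (x l)) × Independent x × ∀ i → y i ≈ combinationℚ (c i) x
  basis {zero}  y Ly = 0 , (λ ()) , (λ ()) , (λ ()) , (λ _ _ ()) , λ ()
  basis {suc n} y Ly with basis (y ∘ suc) (Ly ∘ suc)
  ... | k , x , c , Lx , indep , y≈cx
    with em {P = ∃[ c₀ ] y zero ≈ combinationℚ c₀ x}
  ...   | yes (c₀ , y₀≈c₀x) =
    k , x , (c₀ Vector.∷ c) , Lx , indep , λ { zero → y₀≈c₀x ; (suc i) → y≈cx i }
  ...   | no y₀∉span =
    suc k , y zero Vector.∷ x ,
    ((1ℚ Vector.∷ λ _ → 0ℚ) Vector.∷ λ i → 0ℚ Vector.∷ c i) ,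
    (λ { zero → Ly zero ; (suc l) → Lx l }) ,
    independent-∷ indep y₀∉span , λ
    { zero → begin
        y zero                                        ≈⟨ *-identityˡ _ ⟨
        1# * y zero                                   ≈⟨ *-congʳ ι.1#-homo ⟨
        ι 1ℚ * y zero                                 ≈⟨ +-identityʳ _ ⟨
        ι 1ℚ * y zero + 0#
          ≈⟨ +-congˡ (∑-zero λ l → *≈0ˡ ι.0#-homo) ⟨
        ι 1ℚ * y zero + combinationℚ (λ _ → 0ℚ) x     ≈⟨ ∑-suc ⟨
        combinationℚ (1ℚ Vector.∷ λ _ → 0ℚ) (y zero Vector.∷ x) ∎
    ; (suc i) → begin
        y (suc i)                                     ≈⟨ y≈cx i ⟩
        combinationℚ (c i) x                          ≈⟨ +-identityˡ _ ⟨
        0# + combinationℚ (c i) x                     ≈⟨ +-congʳ (*≈0ˡ ι.0#-homo) ⟨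
        ι 0ℚ * y zero + combinationℚ (c i) x          ≈⟨ ∑-suc ⟨
        combinationℚ (0ℚ Vector.∷ c i) (y zero Vector.∷ x) ∎
    }

  module _ {k n} (A : Fin k → Matrix ℚ n n) where
    private
      module P = IntegralDomain ℚ[x k ]
      module ∑P = Sums P.commutativeRing
      module F = IntegralDomain (FractionField.fractionDomain em ℚ[x k ])
      module ∑F = Sums F.commutativeRing
      module LP = LinearAlgebra em ℚ[x k ]
      module LF = LinearAlgebra em (FractionField.fractionDomain em ℚ[x k ])
      open Denominators em ℚ[x k ]
      open Fractions ℚ[x k ] using (embed)

    -- The matrix A(x) before passing to fractions, so that its entries and its kernel vectors can
    -- be evaluated at any point.
    linearForms : Matrix P.Carrier n n
    linearForms i j = ∑P.∑ λ l → constant k (A l i j) P.* variable-x l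

    genericMatrix≈ : ∀ i j → genericMatrix A i j F.≈ embed (linearForms i j)
    genericMatrix≈ i j = R.begin
      genericMatrix A i j
        R.≈⟨ F.reflexive (≡.sym (∑F.∑≡sum _)) ⟩
      ∑F.∑ (λ l → embed (constant k (A l i j)) F.* embed (variable-x l))
        R.≈⟨ ∑F.∑-cong (λ l → embed-* (constant k (A l i j)) (variable-x l)) ⟩
      ∑F.∑ (λ l → embed (constant k (A l i j) P.* variable-x l))
        R.≈⟨ embed-∑ (λ l → constant k (A l i j) P.* variable-x l) ⟩
      embed (linearForms i j) R.∎
      where module R = SetoidReasoning F.setoid

    -- Along the line α + t x over K[t], the constant terms of the linear forms
    -- give the matrix C = A(α), and the coefficients of t give A(x) = M.  The
    -- coefficient of t in A v = 0 is C v₁ + M v₀ = 0, and w₀ annihilates C.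
    module _ (x : Vector Carrier k) (α : Vector ℚ k) where
      private
        S = Univariate.polynomialRing commutativeRing
        module S = CommutativeRing S
        module ∑S = Sums S
        open Univariate commutativeRing using (coeff; at)
        open Coefficients commutativeRing
        module E = Evaluation S (constant-homo ι-homo)
        line : Vector S.Carrier k
        line l = ι (α l) ∷ x l ∷ []
        ev : P.Carrier → S.Carrier
        ev = E.evaluate k line
        module ev = Hom {P.commutativeRing} {S} (E.evaluate-homo k line)

      evaluateℚ : P.Carrier → ℚ
      evaluateℚ = Evalℚ.evaluate k α

      -- Setting t = 0 sends the line to `α`, so both sides are the evaluation in K at the images of
      -- the coordinates of `α`.
      coeff₀-ev : ∀ p → coeff (ev p) 0 ≈ ι (evaluateℚ p)
      coeff₀-ev p = trans
        (evaluate-natural {S} {commutativeRing} (constant-homo ι-homo) ι-homo coeff₀-homo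
           (λ q → refl) k (λ l → refl) p)
        (sym (evaluate-natural {ℚ.+-*-commutativeRing} {commutativeRing} idℚ-homo ι-homo ι-homo
           (λ q → refl) k (λ l → refl) p))

      -- The coefficients of a linear form are constants along the line, so t occurs only through
      -- the coordinates, each with coefficient `x l`.
      coeff₁-ev : ∀ i j → coeff (ev (linearForms i j)) 1 ≈ combinationℚ (λ l → A l i j) x
      coeff₁-ev i j = begin
        coeff (ev (linearForms i j)) 1
          ≈⟨ at (S.trans (ev.∑-homo (λ l → constant k (A l i j) P.* variable-x l))
               (∑S.∑-cong λ l → S.trans
                  (ev.*-homo (constant k (A l i j)) (variable-x l))
                  (S.*-cong (E.evaluate-constant k line (A l i j))
                            (E.evaluate-variable line l)))) 1 ⟩
        coeff (∑S.∑ (λ l → (ι (A l i j) ∷ []) S.* line l)) 1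
          ≈⟨ coeff-∑ (λ l → (ι (A l i j) ∷ []) S.* line l) 1 ⟩
        ∑ (λ l → coeff ((ι (A l i j) ∷ []) S.* line l) 1)
          ≈⟨ ∑-cong (λ l → trans (coeff₁-⊛ (ι (A l i j) ∷ []) (line l))
               (trans (+-congˡ (zeroˡ _)) (+-identityʳ _))) ⟩
        combinationℚ (λ l → A l i j) x ∎

      kernels-pairing : ∀ (M : Matrix Carrier n n) →
        (∀ i j → M i j ≈ combinationℚ (λ l → A l i j) x) →
        ∀ {v w} → LP.Kernel linearForms v → LP.Kernel (λ j i → linearForms i j) w →
        ∑ (λ i → ι (evaluateℚ (w i)) * ∑ (λ j → M i j * ι (evaluateℚ (v j)))) ≈ 0#
      kernels-pairing M M≈Ax {v} {w} ker-v ker-w = begin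
        ∑ (λ i → ω i * ∑ (λ j → M i j * ν j))
          ≈⟨ +-identityˡ _ ⟨
        0# + ∑ (λ i → ω i * ∑ (λ j → M i j * ν j))
          ≈⟨ +-congʳ (trans ∑-assoc (∑-zero λ j → *≈0ˡ (ωC≈0 j))) ⟨
        ∑ (λ i → ω i * ∑ (λ j → C i j * v₁ j)) + ∑ (λ i → ω i * ∑ (λ j → M i j * ν j))
          ≈⟨ ∑-+ ⟨
        ∑ (λ i → ω i * ∑ (λ j → C i j * v₁ j) + ω i * ∑ (λ j → M i j * ν j))
          ≈⟨ ∑-zero (λ i → trans (sym (distribˡ _ _ _)) (*≈0ʳ (Cv₁+Mν≈0 i))) ⟩
        0# ∎
        where
        ω ν v₁ : Vector Carrier n
        ω i = ι (evaluateℚ (w i))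
        ν j = ι (evaluateℚ (v j))
        -- The derivative of `v` at `α` in the direction `x`.
        v₁ j = coeff (ev (v j)) 1
        C : Matrix Carrier n n
        C i j = coeff (ev (linearForms i j)) 0
        ev-kernel : ∀ (a u : Vector P.Carrier n) → ∑P.∑ (λ j → a j P.* u j) P.≈ P.0# →
                    ∑S.∑ (λ j → ev (a j) S.* ev (u j)) S.≈ S.0#
        ev-kernel a u au≈0 = S.trans
          (S.sym (S.trans (ev.∑-homo (λ j → a j P.* u j))
                          (∑S.∑-cong λ j → ev.*-homo (a j) (u j))))
          (S.trans (ev.⟦⟧-cong au≈0) ev.0#-homo)
        ωC≈0 : ∀ j → ∑ (λ i → ω i * C i j) ≈ 0#
        ωC≈0 j = begin
          ∑ (λ i → ω i * C i j)
            ≈⟨ ∑-cong (λ i → trans (*-comm _ _) (trans (*-congˡ (sym (coeff₀-ev (w i))))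
                 (sym (coeff₀-⊛ (ev (linearForms i j)) (ev (w i)))))) ⟩
          ∑ (λ i → coeff (ev (linearForms i j) S.* ev (w i)) 0)
            ≈⟨ coeff-∑ (λ i → ev (linearForms i j) S.* ev (w i)) 0 ⟨
          coeff (∑S.∑ (λ i → ev (linearForms i j) S.* ev (w i))) 0
            ≈⟨ at (ev-kernel (λ i → linearForms i j) w (ker-w j)) 0 ⟩
          0# ∎
        Cv₁+Mν≈0 : ∀ i → ∑ (λ j → C i j * v₁ j) + ∑ (λ j → M i j * ν j) ≈ 0#
        Cv₁+Mν≈0 i = begin
          ∑ (λ j → C i j * v₁ j) + ∑ (λ j → M i j * ν j)
            ≈⟨ ∑-+ ⟨
          ∑ (λ j → C i j * v₁ j + M i j * ν j)
            ≈⟨ ∑-cong (λ j → +-congˡ (*-cong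
                 (trans (M≈Ax i j) (sym (coeff₁-ev i j))) (sym (coeff₀-ev (v j))))) ⟩
          ∑ (λ j → C i j * v₁ j + coeff (ev (linearForms i j)) 1 * coeff (ev (v j)) 0)
            ≈⟨ ∑-cong (λ j → coeff₁-⊛ (ev (linearForms i j)) (ev (v j))) ⟨
          ∑ (λ j → coeff (ev (linearForms i j) S.* ev (v j)) 1)
            ≈⟨ coeff-∑ (λ j → ev (linearForms i j) S.* ev (v j)) 1 ⟨
          coeff (∑S.∑ (λ j → ev (linearForms i j) S.* ev (v j))) 1
            ≈⟨ at (ev-kernel (linearForms i) v (ker-v i)) 1 ⟩
          0# ∎

    rank<⇒coefficient : ∀ {r} → Linear.HasRank ℚ⟨x k ⟩ (genericMatrix A) r → r ℕ.< n →
      ∀ (x : Vector Carrier k) (M : Matrix Carrier n n) →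
      (∀ i j → M i j ≈ combinationℚ (λ l → A l i j) x) →
      ∃₂ λ (w v : Vector ℚ n) → (∃[ i ] w i ≢ 0ℚ) × (∃[ i ] v i ≢ 0ℚ) ×
      ∑ (λ i → ι (w i) * ∑ (λ j → M i j * ι (v j))) ≈ 0#
    rank<⇒coefficient rank r<n x M M≈Ax =
      evaluateℚ x α ∘ w , evaluateℚ x α ∘ v ,
      (i , λ wi≡0 → wv≢0 (≡.trans (e.*-homo (w i) (v j))
        (≡.trans (≡.cong (ℚ._* evaluateℚ x α (v j)) wi≡0) (ℚ.*-zeroˡ (evaluateℚ x α (v j)))))) ,
      (j , λ vj≡0 → wv≢0 (≡.trans (e.*-homo (w i) (v j))
        (≡.trans (≡.cong (evaluateℚ x α (w i) ℚ.*_) vj≡0) (ℚ.*-zeroʳ (evaluateℚ x α (w i)))))) ,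
      kernels-pairing x α M M≈Ax ker-v ker-w
      where
      right : LP.Singular linearForms
      right = embed-singular (genericMatrix A) linearForms genericMatrix≈
        (LF.rank<⇒singular (genericMatrix A) rank r<n)
      left : LP.Singular (λ j i → linearForms i j)
      left = embed-singular (λ j i → genericMatrix A i j) (λ j i → linearForms i j)
        (λ j i → genericMatrix≈ i j) (LF.rank<⇒singularᵀ (genericMatrix A) rank r<n)
      v = proj₁ right
      j = proj₁ (proj₁ (proj₂ right))
      ker-v = proj₂ (proj₂ right)
      w = proj₁ left
      i = proj₁ (proj₁ (proj₂ left))
      ker-w = proj₂ (proj₂ left)
      -- The product of a nonzero entry of `w` and one of `v` is a nonzero polynomial. Where it does
      -- not vanish, neither entry does, so both specialised vectors are nonzero.
      nonzero : ∃[ α ] Evalℚ.evaluate k α (w i P.* v j) ≢ 0ℚ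
      nonzero = nonvanishing em k (w i P.* v j) (Fractions.*-nonzero ℚ[x k ]
        (proj₂ (proj₁ (proj₂ left))) (proj₂ (proj₁ (proj₂ right))))
      α = proj₁ nonzero
      wv≢0 = proj₂ nonzero
      module e = Hom {P.commutativeRing} {ℚ.+-*-commutativeRing} (Evalℚ.evaluate-homo k α)

  opaque
    unfolding ∑

    -- Together with the next two, this passes between the opaque `∑` and the `sum` of the
    -- conjectures; they coincide once `∑` unfolds.
    independentOverℚ : ∀ {k} {x : Vector Carrier k} → Independent x → LinearlyIndependentOverℚ x
    independentOverℚ indep = indep

    combinationOverℚ : ∀ {k y} {c : Vector ℚ k} {x} → y ≈ combinationℚ c x →
      y ≈ RawSemiringDefs.sum (RawRing.rawSemiring rawRing) (λ l → ι (c l) * x l)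
    combinationOverℚ e = e

    pairing≈0 : ∀ {n} {M : Matrix Carrier n n} {w v : Vector ℚ n} →
                ∑ (λ i → ι (w i) * ∑ (λ j → M i j * ι (v j))) ≈ 0# →
                ⟨ ι ∘ w , M · (ι ∘ v) ⟩ ≈ 0#
    pairing≈0 e = e

  structuralRank⇒matrixCoefficient : StructuralRankConjecture → MatrixCoefficientConjecture
  structuralRank⇒matrixCoefficient structuralRank n 1≤n M LM det≈0 =
    -- The entries are listed as one vector of length n², so that a single basis expresses all of
    -- them.
    conclude (basis (λ p → M (row p) (column p)) (λ p → LM (row p) (column p)))
    where
    row column : Fin (n ℕ.* n) → Fin n
    row    p = proj₁ (remQuot {n} n p)
    column p = proj₂ (remQuot {n} n p)
    Conclusion : Set
    Conclusion = ∃₂ λ (w v : Vector ℚ n) → (∃[ i ] w i ≢ 0ℚ) × (∃[ i ] v i ≢ 0ℚ) ×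
                 ⟨ ι ∘ w , M · (ι ∘ v) ⟩ ≈ 0#
    conclude : (∃[ k ] ∃₂ λ (x : Vector Carrier k) (c : Fin (n ℕ.* n) → Vector ℚ k) →
                (∀ l → L (x l)) × Independent x ×
                ∀ p → M (row p) (column p) ≈ combinationℚ (c p) x) → Conclusion
    conclude (k , x , c , Lx , indep , M≈cx) =
      let w , v , w≢0 , v≢0 , wMv≈0 = coefficient
      in  w , v , w≢0 , v≢0 , pairing≈0 {M = M} {w} {v} wMv≈0
      where
      A : Fin k → Matrix ℚ n n
      A l i j = c (combine i j) l
      M≈Ax : ∀ i j → M i j ≈ combinationℚ (λ l → A l i j) x
      M≈Ax i j = trans
        (reflexive (≡.sym (≡.cong (λ (i , j) → M i j) (Fin.remQuot-combine i j))))
        (M≈cx (combine i j))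
      ranks : ∃[ r ] HasRank M r × Linear.HasRank ℚ⟨x k ⟩ (genericMatrix A) r
      ranks = structuralRank n n 1≤n 1≤n M LM k A x Lx (independentOverℚ {k} {x} indep)
        (λ i j → combinationOverℚ {k} {M i j} {λ l → A l i j} {x} (M≈Ax i j))
      coefficient = rank<⇒coefficient A (proj₂ (proj₂ ranks))
        (singular⇒rank< M (det≈0⇒singular M det≈0) (proj₁ (proj₂ ranks))) x M M≈Ax

-- The complex and the p-adic case

ℂₚ-domain : ExcludedMiddle 0ℓ → ∀ {p} → ℂₚ-Field p → IntegralDomain
ℂₚ-domain em C = record
  { commutativeRing = commutativeRing
  ; 1≉0             = 1≉0
  ; noZeroDivisors  = noZeroDivisors
  }
  where
  open ℂₚ-Field C
  open CommutativeRing commutativeRing using (trans; sym)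
  noZeroDivisors : ∀ x y → x * y ≈ 0# → x ≈ 0# ⊎ y ≈ 0#
  noZeroDivisors x y xy≈0 with em {P = x ≈ 0#}
  ... | yes x≈0 = inj₁ x≈0
  ... | no  x≉0 with inverse x x≉0
  ...   | z , xz≈1 = inj₂ (trans (sym (*-identityˡ y)) (trans (*-congʳ (sym xz≈1))
    (trans (*-congʳ (*-comm x z)) (trans (*-assoc z x y) (trans (*-congˡ xy≈0) (zeroʳ z))))))

-- The equation K ≡ rawRing keeps ℂ-rawRing from being compared, after unfolding
-- the conjectures, with the raw ring underlying ℂ-domain.
structuralRank⇒matrixCoefficient : ExcludedMiddle 0ℓ →
  (R : IntegralDomain) (K : RawRing 0ℓ 0ℓ) → K ≡ IntegralDomain.rawRing R →
  (ι : ℚ → RawRing.Carrier K) →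
  RingMorphisms.IsRingHomomorphism ℚ.+-*-rawRing K ι →
  (L : Pred (RawRing.Carrier K) 0ℓ) →
  Conjectures.StructuralRankConjecture K ι L → Conjectures.MatrixCoefficientConjecture K ι L
structuralRank⇒matrixCoefficient em R _ ≡.refl ι ι-homo L =
  Implication.structuralRank⇒matrixCoefficient em R ι-homo L

theorem2p1 : ExcludedMiddle 0ℓ →
    (Conjectures.StructuralRankConjecture ℂ-rawRing ℚ→ℂ ℒ →
    Conjectures.MatrixCoefficientConjecture ℂ-rawRing ℚ→ℂ ℒ) ×
    (∀ (p : ℕ) → Prime p → (C : ℂₚ-Field p) (logₚ : ℂₚ-Field.IwasawaLog C) →
    Conjectures.StructuralRankConjecture (ℂₚ-Field.rawRing C) (ℂₚ-Field.ι C) (ℂₚ-Field.ℒₚ C logₚ) →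
    Conjectures.MatrixCoefficientConjecture (ℂₚ-Field.rawRing C) (ℂₚ-Field.ι C) (ℂₚ-Field.ℒₚ C logₚ))
theorem2p1 em =
  structuralRank⇒matrixCoefficient em (ℂ-domain em) ℂ-rawRing ≡.refl ℚ→ℂ ℚ→ℂ-homo ℒ ,
  λ p _ C logₚ → structuralRank⇒matrixCoefficient em (ℂₚ-domain em C) (ℂₚ-Field.rawRing C)
    ≡.refl (ℂₚ-Field.ι C) (ℂₚ-Field.ι-homo C) (ℂₚ-Field.ℒₚ C logₚ)
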